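{- Let $f_d\in\mathbb{Z}[t]$ be an irreducible polynomial of degree $d$ with leading coefficient $A$, and define $\phi_d(x,y)=y^df_d(x/y)$. Suppose that there exists a quadratic polynomial $g\in\mathbb{Q}[t]$ such that $f_d(g(t))$ is reducible in $\mathbb{Q}[t]$. Then the equation $Az^2=\phi_d(x,y)$ has a solution $(x,y,z)\in\mathbb{Q}^3$ with $yz\ne 0$. -}

module Defs where

open import Algebra.Bundles.Raw using (RawSemiring)
import Algebra.Definitions.RawSemiring as SemiringDefs
open import Data.Integer.Base as ℤ using (ℤ)
open import Data.List.Base using (List; []; _∷_; map; foldr)
open import Data.Nat.Base using (ℕ; zero; suc; _<_)
open import Data.Product.Base using (_×_; ∃₂)
open import Data.Rational.Base as ℚ using (ℚ)
open import Level using (_⊔_)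
open import Relation.Nullary.Negation.Core using (¬_)

-- Univariate polynomials as coefficient lists, constant term first.
-- Trailing zeros are allowed, so equality is coefficientwise and the
-- degree is not read off from the length of the list.
module Polynomial {a ℓ} (R : RawSemiring a ℓ) where

  open RawSemiring R

  Poly : Set a
  Poly = List Carrier

  coeff : Poly → ℕ → Carrier
  coeff []      n       = 0#
  coeff (c ∷ p) zero    = c
  coeff (c ∷ p) (suc n) = coeff p n

  infix  4 _≋_
  infixl 6 _⊕_
  infixl 7 _⊛_

  _≋_ : Poly → Poly → Set ℓ
  p ≋ q = ∀ n → coeff p n ≈ coeff q n

  _⊕_ : Poly → Poly → Poly
  []      ⊕ q       = q
  (c ∷ p) ⊕ []      = c ∷ p
  (c ∷ p) ⊕ (e ∷ q) = (c + e) ∷ (p ⊕ q)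

  _⊛_ : Poly → Poly → Poly
  []      ⊛ q = []
  (c ∷ p) ⊛ q = map (c *_) q ⊕ (0# ∷ (p ⊛ q))

  polyRawSemiring : RawSemiring a ℓ
  polyRawSemiring = record
    { Carrier = Poly
    ; _≈_     = _≋_
    ; _+_     = _⊕_
    ; _*_     = _⊛_
    ; 0#      = []
    ; 1#      = 1# ∷ []
    }

  HasDegree : Poly → ℕ → Set ℓ
  HasDegree p d = ¬ (coeff p d ≈ 0#) × (∀ n → d < n → coeff p n ≈ 0#)

  eval : Poly → Carrier → Carrier
  eval p x = foldr (λ c v → c + x * v) 0# p

  -- compose p q is p(q(t)).
  compose : Poly → Poly → Poly
  compose p q = foldr (λ c r → (c ∷ []) ⊕ q ⊛ r) [] p

-- The positive counterpart of the library's Irreducible: a nonzero element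
-- that is a product of two non-units.
module _ {a ℓ} (R : RawSemiring a ℓ) where

  open RawSemiring R
  open SemiringDefs R using (_∤_)

  Reducible : Carrier → Set (a ⊔ ℓ)
  Reducible p = ¬ (p ≈ 0#) × ∃₂ λ u v → p ≈ u * v × u ∤ 1# × v ∤ 1#

module ℤ[t] = Polynomial ℤ.+-*-rawSemiring
module ℚ[t] = Polynomial ℚ.+-*-rawSemiring

open SemiringDefs ℚ.+-*-rawSemiring public using () renaming (_^_ to _^ℚ_)

IrreducibleInℤ[t] : ℤ[t].Poly → Set
IrreducibleInℤ[t] = SemiringDefs.Irreducible ℤ[t].polyRawSemiring

ReducibleInℚ[t] : ℚ[t].Poly → Set
ReducibleInℚ[t] = Reducible ℚ[t].polyRawSemiring

fromℤ : ℤ → ℚ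
fromℤ i = i ℚ./ 1

fromℤ[t] : ℤ[t].Poly → ℚ[t].Poly
fromℤ[t] = map fromℤ

φ : ℕ → ℤ[t].Poly → (x y : ℚ) → .{{_ : ℚ.NonZero y}} → ℚ
φ d f x y = (y ^ℚ d) ℚ.* ℚ[t].eval (fromℤ[t] f) (x ℚ.÷ y)

module Submission where

-- Complete the square, g = a (t + β)² + e. Then ℚ[t] is free over ℚ[g] with
-- basis 1, T = t + β, and since T² = (g - e) / a the norm of r(g) + T s(g) is
-- N(g) with N = r² + ((e - t) / a) s². A factorisation f(g) = u v gives norms
-- with product f², and f is prime in ℚ[t] (Gauss and Euclid), so the norm of a
-- non-unit factor is κ f for a constant κ. At t = e this reads κ f(e) = r(e)²;
-- the two summands of N have degrees of different parity, so comparing leading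
-- coefficients makes κ A (- a)ᵈ a square as well. Hence A (- a)ᵈ f(e) is a
-- square, which solves the equation with y = - a and x = e y. It is nonzero
-- unless e is a root of f, and then f is linear.

open import Defs
open import Algebra.Bundles using (CommutativeMonoid; CommutativeRing; CommutativeSemiring)
open import Algebra.Bundles.Raw using (RawSemiring)
open import Algebra.Structures using (IsCommutativeSemiring)
open import Algebra.Structures.Biased using (isCommutativeSemiringˡ)
open import Data.List.Base using ([]; _∷_; foldr; map)
open import Data.Nat.Base as ℕ using (ℕ; zero; suc; z≤n; s≤s; _≤_)
import Data.Nat.Properties as ℕ
open import Data.Product.Base using (Σ; _×_; _,_; proj₁; proj₂; ∃-syntax; ∃₂)
open import Relation.Binary.Bundles using (Setoid)
import Relation.Binary.Reasoning.Setoid as SetoidReasoning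

-- The polynomial `g` defines a double cover of the line by itself, branched over two points: the
-- critical value `e` and infinity. These are the places where a norm is a square up to a known
-- factor, seen in its value at `e` and in its leading coefficient. The unknown constant `κ` enters
-- each of the two conditions once, so it drops out of their product.
--
-- No extension ring is built. An element is carried by its coordinates (r, s), and their uniqueness
-- comes from degrees: r(g) has even degree and T s(g) has odd degree, so leading terms cannot
-- cancel. The same parity governs the leading coefficient of the norm.
--
-- Polynomials are treated as a commutative semiring, so that one development serves coefficients in
-- ℤ and in ℚ as well as composition. Subtraction is expressed over ℚ by `neg`, the multiple by -1,
-- or by pairs such as `μ` and `δ` whose sum is zero.

module PolynomialSemiring {a ℓ} (R : RawSemiring a ℓ)
  (isCS : IsCommutativeSemiring (RawSemiring._≈_ R) (RawSemiring._+_ R)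
            (RawSemiring._*_ R) (RawSemiring.0# R) (RawSemiring.1# R)) where

  open Polynomial R
  coefficients : CommutativeSemiring a ℓ
  coefficients = record { isCommutativeSemiring = isCS }

  open CommutativeSemiring coefficients
  private module Coeff = SetoidReasoning setoid

  -- A record, because both polynomials can be inferred from a proof of p ≈ₚ q
  -- but not from a proof of the function type p ≋ q.
  infix 4 _≈ₚ_
  record _≈ₚ_ (p q : Poly) : Set ℓ where
    constructor ⟨_⟩
    field coeff-≈ : p ≋ q
  open _≈ₚ_ public

  polySetoid : Setoid a ℓ
  polySetoid = record
    { _≈_ = _≈ₚ_
    ; isEquivalence = record
      { refl  = ⟨ (λ _ → refl) ⟩
      ; sym   = λ p≈q → ⟨ (λ n → sym (coeff-≈ p≈q n)) ⟩
      ; trans = λ p≈q q≈r → ⟨ (λ n → trans (coeff-≈ p≈q n) (coeff-≈ q≈r n)) ⟩ } }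

  open Setoid polySetoid using ()
    renaming (refl to ≈ₚ-refl; sym to ≈ₚ-sym; trans to ≈ₚ-trans)
  private module Polys = SetoidReasoning polySetoid

  infixl 7 _·_
  _·_ : Carrier → Poly → Poly
  c · p = map (c *_) p

  -- Semiring laws for coefficient lists

  coeff-⊕ : ∀ p q n → coeff (p ⊕ q) n ≈ coeff p n + coeff q n
  coeff-⊕ []      q       n       = sym (+-identityˡ _)
  coeff-⊕ (c ∷ p) []      n       = sym (+-identityʳ _)
  coeff-⊕ (c ∷ p) (e ∷ q) zero    = refl
  coeff-⊕ (c ∷ p) (e ∷ q) (suc n) = coeff-⊕ p q n

  coeff-· : ∀ c p n → coeff (c · p) n ≈ c * coeff p n
  coeff-· c []      n       = sym (zeroʳ c)
  coeff-· c (e ∷ p) zero    = refl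
  coeff-· c (e ∷ p) (suc n) = coeff-· c p n

  coeff-⊛-zero : ∀ c p q → coeff ((c ∷ p) ⊛ q) 0 ≈ c * coeff q 0
  coeff-⊛-zero c p q = trans (coeff-⊕ (c · q) _ 0)
    (trans (+-identityʳ _) (coeff-· c q 0))

  coeff-⊛-suc : ∀ c p q n →
    coeff ((c ∷ p) ⊛ q) (suc n) ≈ c * coeff q (suc n) + coeff (p ⊛ q) n
  coeff-⊛-suc c p q n = trans (coeff-⊕ (c · q) _ (suc n)) (+-congʳ (coeff-· c q (suc n)))

  ∷-cong : ∀ {c e p q} → c ≈ e → p ≈ₚ q → c ∷ p ≈ₚ e ∷ q
  ∷-cong c≈e p≈q = ⟨ (λ { zero → c≈e ; (suc n) → coeff-≈ p≈q n }) ⟩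

  tail-≈ : ∀ {c e p q} → c ∷ p ≈ₚ e ∷ q → p ≈ₚ q
  tail-≈ eq = ⟨ (λ n → coeff-≈ eq (suc n)) ⟩

  tail-≈0 : ∀ {c p} → c ∷ p ≈ₚ [] → p ≈ₚ []
  tail-≈0 eq = ⟨ (λ n → coeff-≈ eq (suc n)) ⟩

  0∷-≈0 : ∀ {p} → p ≈ₚ [] → 0# ∷ p ≈ₚ []
  0∷-≈0 p≈0 = ⟨ (λ { zero → refl ; (suc n) → coeff-≈ p≈0 n }) ⟩

  ⊕-cong : ∀ {p p′ q q′} → p ≈ₚ p′ → q ≈ₚ q′ → p ⊕ q ≈ₚ p′ ⊕ q′
  ⊕-cong {p} {p′} {q} {q′} p≈ q≈ = ⟨ (λ n → trans (coeff-⊕ p q n)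
    (trans (+-cong (coeff-≈ p≈ n) (coeff-≈ q≈ n)) (sym (coeff-⊕ p′ q′ n)))) ⟩

  ⊕-comm : ∀ p q → p ⊕ q ≈ₚ q ⊕ p
  ⊕-comm p q = ⟨ (λ n → trans (coeff-⊕ p q n) (trans (+-comm _ _) (sym (coeff-⊕ q p n)))) ⟩

  ⊕-assoc : ∀ p q r → (p ⊕ q) ⊕ r ≈ₚ p ⊕ (q ⊕ r)
  ⊕-assoc p q r = ⟨ (λ n → Coeff.begin
    coeff (p ⊕ q ⊕ r) n                  Coeff.≈⟨ coeff-⊕ (p ⊕ q) r n ⟩
    coeff (p ⊕ q) n + coeff r n          Coeff.≈⟨ +-congʳ (coeff-⊕ p q n) ⟩
    coeff p n + coeff q n + coeff r n    Coeff.≈⟨ +-assoc _ _ _ ⟩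
    coeff p n + (coeff q n + coeff r n)  Coeff.≈⟨ +-congˡ (coeff-⊕ q r n) ⟨
    coeff p n + coeff (q ⊕ r) n          Coeff.≈⟨ coeff-⊕ p (q ⊕ r) n ⟨
    coeff (p ⊕ (q ⊕ r)) n                Coeff.∎) ⟩

  ⊕-identityʳ : ∀ p → p ⊕ [] ≈ₚ p
  ⊕-identityʳ p = ⊕-comm p []

  ⊕-commutativeMonoid : CommutativeMonoid a ℓ
  ⊕-commutativeMonoid = record
    { Carrier = Poly
    ; isCommutativeMonoid = record
      { isMonoid = record
        { isSemigroup = record
          { isMagma = record { isEquivalence = Setoid.isEquivalence polySetoid ; ∙-cong = ⊕-cong }
          ; assoc = ⊕-assoc }
        ; identity = (λ _ → ≈ₚ-refl) , ⊕-identityʳ }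
      ; comm = ⊕-comm } }

  open import Algebra.Properties.CommutativeSemigroup
    (CommutativeMonoid.commutativeSemigroup ⊕-commutativeMonoid)
    using (interchange; x∙yz≈y∙xz)

  ·-cong : ∀ {c e p q} → c ≈ e → p ≈ₚ q → c · p ≈ₚ e · q
  ·-cong {c} {e} {p} {q} c≈e p≈q = ⟨ (λ n → trans (coeff-· c p n)
    (trans (*-cong c≈e (coeff-≈ p≈q n)) (sym (coeff-· e q n)))) ⟩

  ·-distribˡ-⊕ : ∀ c p q → c · (p ⊕ q) ≈ₚ c · p ⊕ c · q
  ·-distribˡ-⊕ c p q = ⟨ (λ n → Coeff.begin
    coeff (c · (p ⊕ q)) n                  Coeff.≈⟨ coeff-· c (p ⊕ q) n ⟩
    c * coeff (p ⊕ q) n                    Coeff.≈⟨ *-congˡ (coeff-⊕ p q n) ⟩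
    c * (coeff p n + coeff q n)            Coeff.≈⟨ distribˡ _ _ _ ⟩
    c * coeff p n + c * coeff q n          Coeff.≈⟨ +-cong (coeff-· c p n) (coeff-· c q n) ⟨
    coeff (c · p) n + coeff (c · q) n      Coeff.≈⟨ coeff-⊕ (c · p) (c · q) n ⟨
    coeff (c · p ⊕ c · q) n                Coeff.∎) ⟩

  ·-distribʳ-+ : ∀ c e p → (c + e) · p ≈ₚ c · p ⊕ e · p
  ·-distribʳ-+ c e p = ⟨ (λ n → Coeff.begin
    coeff ((c + e) · p) n                  Coeff.≈⟨ coeff-· (c + e) p n ⟩
    (c + e) * coeff p n                    Coeff.≈⟨ distribʳ _ _ _ ⟩
    c * coeff p n + e * coeff p n          Coeff.≈⟨ +-cong (coeff-· c p n) (coeff-· e p n) ⟨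
    coeff (c · p) n + coeff (e · p) n      Coeff.≈⟨ coeff-⊕ (c · p) (e · p) n ⟨
    coeff (c · p ⊕ e · p) n                Coeff.∎) ⟩

  ·-assoc : ∀ c e p → (c * e) · p ≈ₚ c · (e · p)
  ·-assoc c e p = ⟨ (λ n → Coeff.begin
    coeff ((c * e) · p) n   Coeff.≈⟨ coeff-· (c * e) p n ⟩
    c * e * coeff p n       Coeff.≈⟨ *-assoc _ _ _ ⟩
    c * (e * coeff p n)     Coeff.≈⟨ *-congˡ (coeff-· e p n) ⟨
    c * coeff (e · p) n     Coeff.≈⟨ coeff-· c (e · p) n ⟨
    coeff (c · (e · p)) n   Coeff.∎) ⟩

  ·-zeroˡ : ∀ p → 0# · p ≈ₚ []
  ·-zeroˡ p = ⟨ (λ n → trans (coeff-· 0# p n) (zeroˡ _)) ⟩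

  ·-identityˡ : ∀ p → 1# · p ≈ₚ p
  ·-identityˡ p = ⟨ (λ n → trans (coeff-· 1# p n) (*-identityˡ _)) ⟩

  0∷-⊕ : ∀ p q → 0# ∷ (p ⊕ q) ≈ₚ (0# ∷ p) ⊕ (0# ∷ q)
  0∷-⊕ p q = ∷-cong (sym (+-identityˡ 0#)) ≈ₚ-refl

  ·-0∷ : ∀ c p → c · (0# ∷ p) ≈ₚ 0# ∷ (c · p)
  ·-0∷ c p = ∷-cong (zeroʳ c) ≈ₚ-refl

  ⊛-zeroʳ : ∀ p → p ⊛ [] ≈ₚ []
  ⊛-zeroʳ []      = ≈ₚ-refl
  ⊛-zeroʳ (c ∷ p) = 0∷-≈0 (⊛-zeroʳ p)

  -- The mirror image of the defining recursion of `_⊛_`, which is on the left factor. With both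
  -- recursions available, commutativity is an induction on one list.
  ⊛-∷ʳ : ∀ p c q → p ⊛ (c ∷ q) ≈ₚ c · p ⊕ (0# ∷ (p ⊛ q))
  ⊛-∷ʳ []      c q = ≈ₚ-sym (0∷-≈0 ≈ₚ-refl)
  ⊛-∷ʳ (e ∷ p) c q = ∷-cong (+-congʳ (*-comm e c)) (Polys.begin
    e · q ⊕ p ⊛ (c ∷ q)                  Polys.≈⟨ ⊕-cong ≈ₚ-refl (⊛-∷ʳ p c q) ⟩
    e · q ⊕ (c · p ⊕ (0# ∷ (p ⊛ q)))     Polys.≈⟨ x∙yz≈y∙xz (e · q) (c · p) (0# ∷ (p ⊛ q)) ⟩
    c · p ⊕ (e · q ⊕ (0# ∷ (p ⊛ q)))     Polys.∎)

  ⊛-congˡ : ∀ p {q r} → q ≈ₚ r → p ⊛ q ≈ₚ p ⊛ r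
  ⊛-congˡ []      q≈r = ≈ₚ-refl
  ⊛-congˡ (c ∷ p) q≈r = ⊕-cong (·-cong refl q≈r) (∷-cong refl (⊛-congˡ p q≈r))

  ⊛-comm : ∀ p q → p ⊛ q ≈ₚ q ⊛ p
  ⊛-comm []      q = ≈ₚ-sym (⊛-zeroʳ q)
  ⊛-comm (c ∷ p) q = Polys.begin
    c · q ⊕ (0# ∷ (p ⊛ q))   Polys.≈⟨ ⊕-cong ≈ₚ-refl (∷-cong refl (⊛-comm p q)) ⟩
    c · q ⊕ (0# ∷ (q ⊛ p))   Polys.≈⟨ ⊛-∷ʳ q c p ⟨
    q ⊛ (c ∷ p)              Polys.∎

  -- Equal left factors may be lists of different lengths, so the recursion on them does not run in
  -- step; commutativity moves each change to the right factor.
  ⊛-cong : ∀ {p p′ q q′} → p ≈ₚ p′ → q ≈ₚ q′ → p ⊛ q ≈ₚ p′ ⊛ q′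
  ⊛-cong {p} {p′} {q} {q′} p≈ q≈ = Polys.begin
    p ⊛ q     Polys.≈⟨ ⊛-congˡ p q≈ ⟩
    p ⊛ q′    Polys.≈⟨ ⊛-comm p q′ ⟩
    q′ ⊛ p    Polys.≈⟨ ⊛-congˡ q′ p≈ ⟩
    q′ ⊛ p′   Polys.≈⟨ ⊛-comm q′ p′ ⟩
    p′ ⊛ q′   Polys.∎

  ⊛-distribʳ : ∀ r p q → (p ⊕ q) ⊛ r ≈ₚ p ⊛ r ⊕ q ⊛ r
  ⊛-distribʳ r []      q       = ≈ₚ-refl
  ⊛-distribʳ r (c ∷ p) []      = ≈ₚ-sym (⊕-identityʳ _)
  ⊛-distribʳ r (c ∷ p) (e ∷ q) = Polys.begin
    (c + e) · r ⊕ (0# ∷ ((p ⊕ q) ⊛ r))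
      Polys.≈⟨ ⊕-cong (·-distribʳ-+ c e r)
                 (≈ₚ-trans (∷-cong refl (⊛-distribʳ r p q)) (0∷-⊕ (p ⊛ r) (q ⊛ r))) ⟩
    (c · r ⊕ e · r) ⊕ ((0# ∷ (p ⊛ r)) ⊕ (0# ∷ (q ⊛ r)))
      Polys.≈⟨ interchange (c · r) (e · r) (0# ∷ (p ⊛ r)) (0# ∷ (q ⊛ r)) ⟩
    (c ∷ p) ⊛ r ⊕ (e ∷ q) ⊛ r Polys.∎

  ·-⊛ : ∀ c p q → (c · p) ⊛ q ≈ₚ c · (p ⊛ q)
  ·-⊛ c []      q = ≈ₚ-refl
  ·-⊛ c (e ∷ p) q = Polys.begin
    (c * e) · q ⊕ (0# ∷ ((c · p) ⊛ q))
      Polys.≈⟨ ⊕-cong (·-assoc c e q) (∷-cong refl (·-⊛ c p q)) ⟩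
    c · (e · q) ⊕ (0# ∷ (c · (p ⊛ q)))
      Polys.≈⟨ ⊕-cong (≈ₚ-refl {c · (e · q)}) (·-0∷ c (p ⊛ q)) ⟨
    c · (e · q) ⊕ c · (0# ∷ (p ⊛ q))
      Polys.≈⟨ ·-distribˡ-⊕ c (e · q) (0# ∷ (p ⊛ q)) ⟨
    c · ((e ∷ p) ⊛ q) Polys.∎

  0∷-⊛ : ∀ p q → (0# ∷ p) ⊛ q ≈ₚ 0# ∷ (p ⊛ q)
  0∷-⊛ p q = ⊕-cong (·-zeroˡ q) ≈ₚ-refl

  ⊛-assoc : ∀ p q r → (p ⊛ q) ⊛ r ≈ₚ p ⊛ (q ⊛ r)
  ⊛-assoc []      q r = ≈ₚ-refl
  ⊛-assoc (c ∷ p) q r = Polys.begin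
    (c · q ⊕ (0# ∷ (p ⊛ q))) ⊛ r
      Polys.≈⟨ ⊛-distribʳ r (c · q) (0# ∷ (p ⊛ q)) ⟩
    (c · q) ⊛ r ⊕ (0# ∷ (p ⊛ q)) ⊛ r
      Polys.≈⟨ ⊕-cong (·-⊛ c q r) (≈ₚ-trans (0∷-⊛ (p ⊛ q) r) (∷-cong refl (⊛-assoc p q r))) ⟩
    c · (q ⊛ r) ⊕ (0# ∷ (p ⊛ (q ⊛ r))) Polys.∎

  [_]⊛ : ∀ c p → (c ∷ []) ⊛ p ≈ₚ c · p
  [ c ]⊛ p = ≈ₚ-trans (⊕-cong (≈ₚ-refl {c · p}) (0∷-≈0 ≈ₚ-refl)) (⊕-identityʳ (c · p))

  ⊛-identityˡ : ∀ p → (1# ∷ []) ⊛ p ≈ₚ p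
  ⊛-identityˡ p = ≈ₚ-trans ([ 1# ]⊛ p) (·-identityˡ p)

  polySemiring : CommutativeSemiring a ℓ
  polySemiring = record
    { Carrier = Poly ; _≈_ = _≈ₚ_ ; _+_ = _⊕_ ; _*_ = _⊛_ ; 0# = [] ; 1# = 1# ∷ []
    ; isCommutativeSemiring = isCommutativeSemiringˡ (record
      { +-isCommutativeMonoid = CommutativeMonoid.isCommutativeMonoid ⊕-commutativeMonoid
      ; *-isCommutativeMonoid = record
        { isMonoid = record
          { isSemigroup = record
            { isMagma = record { isEquivalence = Setoid.isEquivalence polySetoid ; ∙-cong = ⊛-cong }
            ; assoc = ⊛-assoc }
          ; identity = ⊛-identityˡ , λ p → ≈ₚ-trans (⊛-comm p (1# ∷ [])) (⊛-identityˡ p) }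
        ; comm = ⊛-comm }
      ; distribʳ = ⊛-distribʳ
      ; zeroˡ = λ _ → ≈ₚ-refl }) }

  ·-⊛ʳ : ∀ k p q → p ⊛ (k · q) ≈ₚ k · (p ⊛ q)
  ·-⊛ʳ k p q = Polys.begin
    p ⊛ (k · q)   Polys.≈⟨ ⊛-comm p (k · q) ⟩
    (k · q) ⊛ p   Polys.≈⟨ ·-⊛ k q p ⟩
    k · (q ⊛ p)   Polys.≈⟨ ·-cong {k} refl (⊛-comm q p) ⟩
    k · (p ⊛ q)   Polys.∎

  -- Strict degree bounds, with bound 0 for the zero polynomial

  record DegreeBelow (p : Poly) (m : ℕ) : Set ℓ where
    constructor below
    field vanish : ∀ n → m ≤ n → coeff p n ≈ 0#
  open DegreeBelow public

  below-resp : ∀ {p q m} → p ≈ₚ q → DegreeBelow p m → DegreeBelow q m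
  below-resp p≈q p< = below λ n m≤n → trans (sym (coeff-≈ p≈q n)) (vanish p< n m≤n)

  below-≤ : ∀ {p m n} → m ≤ n → DegreeBelow p m → DegreeBelow p n
  below-≤ m≤n p< = below λ k n≤k → vanish p< k (ℕ.≤-trans m≤n n≤k)

  below-tail : ∀ {c p m} → DegreeBelow (c ∷ p) (suc m) → DegreeBelow p m
  below-tail p< = below λ n m≤n → vanish p< (suc n) (s≤s m≤n)

  below-zero : ∀ {p} → DegreeBelow p 0 → p ≈ₚ []
  below-zero p< = ⟨ (λ n → vanish p< n z≤n) ⟩

  below-constant : ∀ {p} → DegreeBelow p 1 → p ≈ₚ coeff p 0 ∷ []
  below-constant p< = ⟨ (λ { zero → refl ; (suc n) → vanish p< (suc n) (s≤s z≤n) }) ⟩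

  below-⊕ : ∀ {p q m} → DegreeBelow p m → DegreeBelow q m → DegreeBelow (p ⊕ q) m
  below-⊕ {p} {q} p< q< = below λ n m≤n → trans (coeff-⊕ p q n)
    (trans (+-cong (vanish p< n m≤n) (vanish q< n m≤n)) (+-identityˡ 0#))

  -- Both bounds are written as successors so that the bound for the product, one less than their
  -- sum, needs no subtraction.
  below-⊛ : ∀ {p q m n} → DegreeBelow p (suc m) → DegreeBelow q (suc n) →
            DegreeBelow (p ⊛ q) (suc (m ℕ.+ n))
  below-⊛ {[]} p< q< = below λ k _ → refl
  below-⊛ {c ∷ p} {q} {m} {n} p< q< = below λ { (suc k) (s≤s m+n≤k) → Coeff.begin
    coeff ((c ∷ p) ⊛ q) (suc k)             Coeff.≈⟨ coeff-⊛-suc c p q k ⟩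
    c * coeff q (suc k) + coeff (p ⊛ q) k
      Coeff.≈⟨ +-cong (trans (*-congˡ (vanish q< (suc k) (s≤s (ℕ.m+n≤o⇒n≤o m m+n≤k)))) (zeroʳ c))
                      (vanish (tail m p<) k m+n≤k) ⟩
    0# + 0#                                 Coeff.≈⟨ +-identityˡ 0# ⟩
    0#                                      Coeff.∎ }
    where
    tail : ∀ m → DegreeBelow (c ∷ p) (suc m) → DegreeBelow (p ⊛ q) (m ℕ.+ n)
    -- Here the tail is the zero polynomial. The recursive bound would be at least `suc n`, too weak
    -- for the required bound `n`.
    tail zero    p< = below λ k _ → coeff-≈ (⊛-cong (below-zero (below-tail p<)) (≈ₚ-refl {q})) k
    tail (suc m) p< = below-⊛ (below-tail p<) q<

  coeff-⊛-top : ∀ {p q m n} → DegreeBelow p (suc m) → DegreeBelow q (suc n) →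
                coeff (p ⊛ q) (m ℕ.+ n) ≈ coeff p m * coeff q n
  coeff-⊛-top {[]} p< q< = sym (zeroˡ _)
  coeff-⊛-top {c ∷ p} {q} {zero} {n} p< q< =
    trans (coeff-⊕ (c · q) _ n) (trans (+-cong (coeff-· c q n)
      (coeff-≈ (0∷-≈0 (⊛-cong (below-zero (below-tail p<)) (≈ₚ-refl {q}))) n)) (+-identityʳ _))
  coeff-⊛-top {c ∷ p} {q} {suc m} {n} p< q< = Coeff.begin
    coeff ((c ∷ p) ⊛ q) (suc (m ℕ.+ n))   Coeff.≈⟨ coeff-⊛-suc c p q (m ℕ.+ n) ⟩
    c * coeff q (suc (m ℕ.+ n)) + coeff (p ⊛ q) (m ℕ.+ n)
      Coeff.≈⟨ +-cong (trans (*-congˡ (vanish q< _ (s≤s (ℕ.m≤n+m n m)))) (zeroʳ c))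
                      (coeff-⊛-top (below-tail p<) q<) ⟩
    0# + coeff p m * coeff q n            Coeff.≈⟨ +-identityˡ _ ⟩
    coeff p m * coeff q n                 Coeff.∎

  -- Evaluation along a map of coefficients: `h` is the identity for values and the embedding of
  -- constants for composition

  module Evaluation {b ℓ′} (T : CommutativeSemiring b ℓ′)
    (h : Carrier → CommutativeSemiring.Carrier T)
    (h-cong : ∀ {c e} → c ≈ e → CommutativeSemiring._≈_ T (h c) (h e))
    (h-0 : CommutativeSemiring._≈_ T (h 0#) (CommutativeSemiring.0# T))
    (h-+ : ∀ c e → CommutativeSemiring._≈_ T (h (c + e)) (CommutativeSemiring._+_ T (h c) (h e)))
    (h-* : ∀ c e → CommutativeSemiring._≈_ T (h (c * e)) (CommutativeSemiring._*_ T (h c) (h e)))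
    (x : CommutativeSemiring.Carrier T) where

    private
      module T = CommutativeSemiring T
      module Values = SetoidReasoning T.setoid
      open import Algebra.Properties.CommutativeSemigroup T.+-commutativeSemigroup
        using () renaming (interchange to +-interchange)
      open import Algebra.Properties.CommutativeSemigroup T.*-commutativeSemigroup
        using () renaming (x∙yz≈y∙xz to *-x∙yz≈y∙xz)

    evaluate : Poly → T.Carrier
    evaluate p = foldr (λ c v → h c T.+ x T.* v) T.0# p

    evaluate-0∷ : ∀ p → evaluate (0# ∷ p) T.≈ x T.* evaluate p
    evaluate-0∷ p = T.trans (T.+-congʳ h-0) (T.+-identityˡ _)

    -- Needed for congruence: when one of two equal lists ends first, the rest of the other consists
    -- of zeros.
    evaluate-≈0 : ∀ {p} → p ≈ₚ [] → evaluate p T.≈ T.0#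
    evaluate-≈0 {[]}    p≈0 = T.refl
    evaluate-≈0 {c ∷ p} p≈0 = Values.begin
      h c T.+ x T.* evaluate p
        Values.≈⟨ T.+-cong (T.trans (h-cong (coeff-≈ p≈0 0)) h-0)
                           (T.*-congˡ (evaluate-≈0 (tail-≈0 p≈0))) ⟩
      T.0# T.+ x T.* T.0#   Values.≈⟨ T.+-identityˡ _ ⟩
      x T.* T.0#            Values.≈⟨ T.zeroʳ x ⟩
      T.0#                  Values.∎

    evaluate-cong : ∀ {p q} → p ≈ₚ q → evaluate p T.≈ evaluate q
    evaluate-cong {[]}    {q}     p≈q = T.sym (evaluate-≈0 (≈ₚ-sym p≈q))
    evaluate-cong {c ∷ p} {[]}    p≈q = evaluate-≈0 p≈q
    evaluate-cong {c ∷ p} {e ∷ q} p≈q =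
      T.+-cong (h-cong (coeff-≈ p≈q 0)) (T.*-congˡ (evaluate-cong (tail-≈ p≈q)))

    evaluate-⊕ : ∀ p q → evaluate (p ⊕ q) T.≈ evaluate p T.+ evaluate q
    evaluate-⊕ []      q       = T.sym (T.+-identityˡ _)
    evaluate-⊕ (c ∷ p) []      = T.sym (T.+-identityʳ _)
    evaluate-⊕ (c ∷ p) (e ∷ q) = Values.begin
      h (c + e) T.+ x T.* evaluate (p ⊕ q)
        Values.≈⟨ T.+-cong (h-+ c e) (T.trans (T.*-congˡ (evaluate-⊕ p q)) (T.distribˡ _ _ _)) ⟩
      (h c T.+ h e) T.+ (x T.* evaluate p T.+ x T.* evaluate q)
        Values.≈⟨ +-interchange _ _ _ _ ⟩
      evaluate (c ∷ p) T.+ evaluate (e ∷ q) Values.∎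

    evaluate-· : ∀ c p → evaluate (c · p) T.≈ h c T.* evaluate p
    evaluate-· c []      = T.sym (T.zeroʳ _)
    evaluate-· c (e ∷ p) = Values.begin
      h (c * e) T.+ x T.* evaluate (c · p)
        Values.≈⟨ T.+-cong (h-* c e)
                    (T.trans (T.*-congˡ (evaluate-· c p)) (*-x∙yz≈y∙xz x (h c) (evaluate p))) ⟩
      h c T.* h e T.+ h c T.* (x T.* evaluate p)
        Values.≈⟨ T.distribˡ _ _ _ ⟨
      h c T.* evaluate (e ∷ p) Values.∎

    evaluate-⊛ : ∀ p q → evaluate (p ⊛ q) T.≈ evaluate p T.* evaluate q
    evaluate-⊛ []      q = T.sym (T.zeroˡ _)
    evaluate-⊛ (c ∷ p) q = Values.begin
      evaluate (c · q ⊕ (0# ∷ (p ⊛ q)))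
        Values.≈⟨ evaluate-⊕ (c · q) (0# ∷ (p ⊛ q)) ⟩
      evaluate (c · q) T.+ evaluate (0# ∷ (p ⊛ q))
        Values.≈⟨ T.+-cong (evaluate-· c q)
                    (T.trans (evaluate-0∷ (p ⊛ q)) (T.*-congˡ (evaluate-⊛ p q))) ⟩
      h c T.* evaluate q T.+ x T.* (evaluate p T.* evaluate q)
        Values.≈⟨ T.+-congˡ (T.*-assoc _ _ _) ⟨
      h c T.* evaluate q T.+ x T.* evaluate p T.* evaluate q
        Values.≈⟨ T.distribʳ _ _ _ ⟨
      evaluate (c ∷ p) T.* evaluate q Values.∎

  module Eval (x : Carrier) = Evaluation coefficients (λ c → c) (λ c≈e → c≈e) refl
    (λ _ _ → refl) (λ _ _ → refl) x

  module Compose (g : Poly) = Evaluation polySemiring (λ c → c ∷ []) (λ c≈e → ∷-cong c≈e ≈ₚ-refl)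
    (0∷-≈0 ≈ₚ-refl) (λ _ _ → ≈ₚ-refl) (λ c e → ∷-cong (sym (+-identityʳ _)) ≈ₚ-refl) g

open import Algebra.Apartness.Properties.HeytingCommutativeRing using (x#0y#0→xy#0)
import Algebra.Definitions.RawSemiring as SemiringDefs
open import Algebra.Definitions.RawMagma using () renaming (_,_ to _∣,_)
open import Data.Integer.Base as ℤ using (ℤ; +_; 0ℤ; 1ℤ)
import Data.Integer.Divisibility.Signed as ℤ
import Data.Integer.Properties as ℤ
open import Data.List.Relation.Unary.All using (All; []; _∷_)
import Data.Nat.Divisibility as ℕ
open import Data.Nat.Induction using (<-rec)
open import Data.Nat.ListAction using (product)
open import Data.Nat.Primality using (Prime; euclidsLemma; prime⇒nonZero)
import Data.Nat.Primality.Factorisation as Factorisation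
open import Data.Rational.Base as ℚ using (ℚ; NonZero; 0ℚ; 1ℚ; _+_; _*_; -_)
import Data.Rational.Properties as ℚ
import Data.Rational.Solver as ℚSolver
open import Data.Rational.Unnormalised.Base as ℚᵘ using (mkℚᵘ; *≡*; _≃_)
import Data.Rational.Unnormalised.Properties as ℚᵘ
open import Data.Sum.Base as Sum using (_⊎_; inj₁; inj₂; [_,_]′)
open import Function.Base using (_∘_; case_of_)
open import Relation.Binary.PropositionalEquality
  using (_≡_; _≢_; refl; sym; trans; cong; cong₂; subst; module ≡-Reasoning)
open import Relation.Nullary using (¬_; yes; no; contradiction)

-- Gauss's lemma over ℤ

module ℤPoly = PolynomialSemiring ℤ.+-*-rawSemiring
  (CommutativeSemiring.isCommutativeSemiring ℤ.+-*-commutativeSemiring)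

module Content where

  open ℤ[t] using (Poly; coeff; _⊕_; _⊛_)
  open ℤPoly
  private module Polys = SetoidReasoning polySetoid
  private module ≈ₚ = CommutativeSemiring polySemiring

  prime-∣-* : ∀ {p} → Prime p → ∀ a b → + p ℤ.∣ a ℤ.* b → + p ℤ.∣ a ⊎ + p ℤ.∣ b
  prime-∣-* {p} p-prime a b p∣ab = Sum.map ℤ.∣ᵤ⇒∣ ℤ.∣ᵤ⇒∣
    (euclidsLemma ℤ.∣ a ∣ ℤ.∣ b ∣ p-prime (subst (p ℕ.∣_) (ℤ.abs-* a b) (ℤ.∣⇒∣ᵤ p∣ab)))

  -- The constant term of the product forces `p` to divide one of the two heads. That head can then
  -- be dropped, since `p` still divides every coefficient of the product of what remains. The usual
  -- argument with the first indivisible coefficients thus becomes an induction on the lists.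
  gauss : ∀ {p} → Prime p → ∀ u v → (∀ n → + p ℤ.∣ coeff (u ⊛ v) n) →
          (∀ n → + p ℤ.∣ coeff u n) ⊎ (∀ n → + p ℤ.∣ coeff v n)
  gauss p-prime []      v       _ = inj₁ λ _ → ℤ.divides 0ℤ refl
  gauss p-prime (a ∷ u) []      _ = inj₂ λ _ → ℤ.divides 0ℤ refl
  gauss {p} p-prime (a ∷ u) (b ∷ v) p∣uv =
    [ (λ p∣a → Sum.map₁ (prepend p∣a) (gauss p-prime u (b ∷ v) (drop a u (b ∷ v) p∣a p∣uv)))
    , (λ p∣b → Sum.map₂ (prepend p∣b) (gauss p-prime (a ∷ u) v (flip v (a ∷ u)
                 (drop b v (a ∷ u) p∣b (flip (a ∷ u) (b ∷ v) p∣uv)))))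
    ]′ (prime-∣-* p-prime a b (subst (+ p ℤ.∣_) (coeff-⊛-zero a u (b ∷ v)) (p∣uv 0)))
    where
    prepend : ∀ {c w} → + p ℤ.∣ c → (∀ n → + p ℤ.∣ coeff w n) → ∀ n → + p ℤ.∣ coeff (c ∷ w) n
    prepend p∣c p∣w zero    = p∣c
    prepend p∣c p∣w (suc n) = p∣w n

    drop : ∀ c w x → + p ℤ.∣ c → (∀ n → + p ℤ.∣ coeff ((c ∷ w) ⊛ x) n) →
           ∀ n → + p ℤ.∣ coeff (w ⊛ x) n
    drop c w x p∣c p∣cwx n = ℤ.∣m+n∣m⇒∣n
      (subst (+ p ℤ.∣_) (coeff-⊛-suc c w x n) (p∣cwx (suc n))) (ℤ.∣m⇒∣m*n _ p∣c)

    flip : ∀ w x → (∀ n → + p ℤ.∣ coeff (w ⊛ x) n) → ∀ n → + p ℤ.∣ coeff (x ⊛ w) n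
    flip w x p∣wx n = subst (+ p ℤ.∣_) (coeff-≈ (⊛-comm w x) n) (p∣wx n)

  divide : ∀ k u → (∀ n → k ℤ.∣ coeff u n) → ∃[ w ] u ≈ₚ k · w
  divide k []      k∣u = [] , ⟨ (λ _ → refl) ⟩
  divide k (c ∷ u) k∣u with k∣u 0 | divide k u (λ n → k∣u (suc n))
  ... | ℤ.divides q c≡qk | w , u≈kw = q ∷ w , ∷-cong (trans c≡qk (ℤ.*-comm q k)) u≈kw

  ·-cancel : ∀ k .{{_ : ℤ.NonZero k}} {p q} → k · p ≈ₚ k · q → p ≈ₚ q
  ·-cancel k {p} {q} kp≈kq = ⟨ (λ n → ℤ.*-cancelˡ-≡ k _ _
    (trans (sym (coeff-· k p n)) (trans (coeff-≈ kp≈kq n) (coeff-· k q n)))) ⟩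

  -- `m` and `n` collect the primes taken out of `u` and `v`. Being nonzero, they allow a unit `u′`
  -- or `v′` to be traced back to `u` or `v` over ℚ.
  record IntegralFactorisation (f u v : Poly) : Set where
    field
      u′ v′   : Poly
      m n     : ℤ
      m≢0     : m ≢ 0ℤ
      n≢0     : n ≢ 0ℤ
      f≈u′v′  : f ≈ₚ u′ ⊛ v′
      u≈mu′   : u ≈ₚ m · u′
      v≈nv′   : v ≈ₚ n · v′

  *-≢0 : ∀ {i j} → i ≢ 0ℤ → j ≢ 0ℤ → i ℤ.* j ≢ 0ℤ
  *-≢0 {i} i≢0 j≢0 ij≡0 = [ i≢0 , j≢0 ]′ (ℤ.i*j≡0⇒i≡0∨j≡0 i ij≡0)

  prime≢0 : ∀ {p} → Prime p → + p ≢ 0ℤ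
  prime≢0 p-prime refl with prime⇒nonZero p-prime
  ... | ()

  -- Each prime divides all coefficients of `u ⊛ v`, hence by `gauss` all those of one factor, and
  -- is divided out of that factor. Working prime by prime avoids contents and greatest common
  -- divisors.
  remove-primes : ∀ {ps} → All Prime ps → ∀ f u v → + product ps · f ≈ₚ u ⊛ v →
                  IntegralFactorisation f u v
  remove-primes [] f u v 1f≈uv = record
    { u′ = u ; v′ = v ; m = 1ℤ ; n = 1ℤ ; m≢0 = λ () ; n≢0 = λ ()
    ; f≈u′v′ = ≈ₚ.trans (≈ₚ.sym (·-identityˡ f)) 1f≈uv
    ; u≈mu′ = ≈ₚ.sym (·-identityˡ u) ; v≈nv′ = ≈ₚ.sym (·-identityˡ v) }
  remove-primes {p ∷ ps} (p-prime ∷ ps-prime) f u v pPf≈uv =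
    [ (λ p∣u → case-u (divide (+ p) u p∣u)) , (λ p∣v → case-v (divide (+ p) v p∣v)) ]′
    (gauss p-prime u v λ n → ℤ.divides (coeff (+ product ps · f) n)
      (trans (sym (coeff-≈ p·Pf≈uv n))
        (trans (coeff-· (+ p) (+ product ps · f) n) (ℤ.*-comm (+ p) _))))
    where
    instance
      +p≢0 : ℤ.NonZero (+ p)
      +p≢0 = ℤ.≢-nonZero (prime≢0 p-prime)

    p·Pf≈uv : + p · (+ product ps · f) ≈ₚ u ⊛ v
    p·Pf≈uv = Polys.begin
      + p · (+ product ps · f)        Polys.≈⟨ ·-assoc (+ p) (+ product ps) f ⟨
      (+ p ℤ.* + product ps) · f      Polys.≈⟨ ·-cong (sym (ℤ.pos-* p (product ps))) (≈ₚ.refl {f}) ⟩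
      + product (p ∷ ps) · f          Polys.≈⟨ pPf≈uv ⟩
      u ⊛ v                           Polys.∎

    case-u : ∃[ w ] u ≈ₚ + p · w → IntegralFactorisation f u v
    case-u (w , u≈pw) = record
      { u′ = u′ ; v′ = v′ ; m = + p ℤ.* m ; n = n ; m≢0 = *-≢0 (prime≢0 p-prime) m≢0 ; n≢0 = n≢0
      ; f≈u′v′ = f≈u′v′
      ; u≈mu′ = ≈ₚ.trans u≈pw (≈ₚ.trans (·-cong {+ p} refl u≈mu′) (≈ₚ.sym (·-assoc (+ p) m u′)))
      ; v≈nv′ = v≈nv′ }
      where
      open IntegralFactorisation (remove-primes ps-prime f w v (·-cancel (+ p) (≈ₚ.trans p·Pf≈uv
        (≈ₚ.trans (⊛-cong u≈pw (≈ₚ.refl {v})) (·-⊛ (+ p) w v)))))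

    case-v : ∃[ w ] v ≈ₚ + p · w → IntegralFactorisation f u v
    case-v (w , v≈pw) = record
      { u′ = u′ ; v′ = v′ ; m = m ; n = + p ℤ.* n ; m≢0 = m≢0 ; n≢0 = *-≢0 (prime≢0 p-prime) n≢0
      ; f≈u′v′ = f≈u′v′
      ; u≈mu′ = u≈mu′
      ; v≈nv′ = ≈ₚ.trans v≈pw (≈ₚ.trans (·-cong {+ p} refl v≈nv′) (≈ₚ.sym (·-assoc (+ p) n v′))) }
      where
      open IntegralFactorisation (remove-primes ps-prime f u w (·-cancel (+ p) (≈ₚ.trans p·Pf≈uv
        (≈ₚ.trans (⊛-congˡ u v≈pw) (·-⊛ʳ (+ p) u w)))))

  integral-factorisation : ∀ D .{{_ : ℕ.NonZero D}} f u v → + D · f ≈ₚ u ⊛ v →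
                           IntegralFactorisation f u v
  integral-factorisation D f u v Df≈uv =
    remove-primes factorsPrime f u v (subst (λ k → + k · f ≈ₚ u ⊛ v) isFactorisation Df≈uv)
    where open Factorisation.PrimeFactorisation (Factorisation.factorise D)

-- Degrees and divisibility in ℚ[t]

module ℚPoly = PolynomialSemiring ℚ.+-*-rawSemiring
  (CommutativeRing.isCommutativeSemiring ℚ.+-*-commutativeRing)

open ℚ[t] using (Poly; coeff; _⊕_; _⊛_; eval; compose)
open ℚPoly
open CommutativeSemiring polySemiring using () renaming
  ( refl to ≈ₚ-refl; sym to ≈ₚ-sym; trans to ≈ₚ-trans; +-congˡ to ⊕-congˡ; +-congʳ to ⊕-congʳ
  ; setoid to ≈ₚ-setoid; semiring to ℚ[t]-semiring
  ; distribˡ to ⊛-distribˡ )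
open import Algebra.Properties.Semiring.Divisibility ℚ[t]-semiring
  using (_∣_; _∤_; ∣ʳ-refl; x∣ʳy⇒x∣ʳzy; ∣ʳ-respʳ-≈; ∣ʳ-respˡ-≈)
open import Algebra.Properties.CommutativeSemigroup
  (CommutativeSemiring.+-commutativeSemigroup polySemiring) using (interchange)
private module Polys = SetoidReasoning ≈ₚ-setoid

*-≢0 : ∀ {x y} → x ≢ 0ℚ → y ≢ 0ℚ → x * y ≢ 0ℚ
*-≢0 = x#0y#0→xy#0 ℚ.heytingCommutativeRing

inverse : ∀ {x} → x ≢ 0ℚ → ∃[ y ] y * x ≡ 1ℚ
inverse {x} x≢0 = ℚ.1/_ x {{ℚ.≢-nonZero x≢0}} , ℚ.*-inverseˡ x {{ℚ.≢-nonZero x≢0}}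

record Degree (p : Poly) (n : ℕ) : Set where
  constructor degree
  field
    leading≢0 : coeff p n ≢ 0ℚ
    beyond    : DegreeBelow p (suc n)
open Degree

hasDegree⇒degree : ∀ {p n} → ℚ[t].HasDegree p n → Degree p n
hasDegree⇒degree (lead , zeros) = degree lead (below zeros)

degree-resp : ∀ {p q n} → p ≈ₚ q → Degree p n → Degree q n
degree-resp {n = n} p≈q (degree lead zeros) =
  degree (λ z → lead (trans (coeff-≈ p≈q n) z)) (below-resp p≈q zeros)

degree-≉0 : ∀ {p n} → Degree p n → ¬ p ≈ₚ []
degree-≉0 {n = n} p° p≈0 = leading≢0 p° (coeff-≈ p≈0 n)

below⇒< : ∀ {p m n} → DegreeBelow p m → Degree p n → n ℕ.< m
below⇒< {n = n} p< p° = ℕ.≰⇒> λ m≤n → leading≢0 p° (vanish p< n m≤n)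

degree-unique : ∀ {p m n} → Degree p m → Degree p n → m ≡ n
degree-unique p°m p°n = ℕ.≤-antisym (ℕ.s≤s⁻¹ (below⇒< (beyond p°n) p°m))
                                    (ℕ.s≤s⁻¹ (below⇒< (beyond p°m) p°n))

zero-or-degree : ∀ p → p ≈ₚ [] ⊎ ∃[ n ] Degree p n
zero-or-degree [] = inj₁ ≈ₚ-refl
zero-or-degree (c ∷ p) with zero-or-degree p
... | inj₂ (n , degree lead zeros) =
  inj₂ (suc n , degree lead (below λ { (suc k) (s≤s n<k) → vanish zeros k n<k }))
... | inj₁ p≈0 with c ℚ.≟ 0ℚ
...   | yes refl = inj₁ (0∷-≈0 p≈0)
...   | no c≢0 = inj₂ (0 , degree c≢0 (below λ { (suc k) _ → coeff-≈ p≈0 k }))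

degree-⊛ : ∀ {p q m n} → Degree p m → Degree q n → Degree (p ⊛ q) (m ℕ.+ n)
degree-⊛ {p} {q} {m} {n} p° q° = degree
  (λ z → *-≢0 (leading≢0 p°) (leading≢0 q°)
           (trans (sym (coeff-⊛-top {p} {q} {m} {n} (beyond p°) (beyond q°))) z))
  (below-⊛ (beyond p°) (beyond q°))

below-⊕-top : ∀ {p q n} → DegreeBelow q n → coeff (p ⊕ q) n ≡ coeff p n
below-⊕-top {p} {q} {n} q< =
  trans (coeff-⊕ p q n) (trans (cong (λ x → coeff p n + x) (vanish q< n ℕ.≤-refl)) (ℚ.+-identityʳ _))

degree-⊕ : ∀ {p q n} → Degree p n → DegreeBelow q n → Degree (p ⊕ q) n
degree-⊕ {p} {q} {n} p° q< = degree
  (λ z → leading≢0 p° (trans (sym (below-⊕-top {p} q<)) z))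
  (below-⊕ (beyond p°) (below-≤ (ℕ.n≤1+n n) q<))

constant-degree : ∀ {c} → c ≢ 0ℚ → Degree (c ∷ []) 0
constant-degree c≢0 = degree c≢0 (below λ { (suc k) _ → refl })

linear-degree : ∀ {c e} → e ≢ 0ℚ → Degree (c ∷ e ∷ []) 1
linear-degree e≢0 = degree e≢0 (below λ { (suc zero) (s≤s ()) ; (suc (suc k)) _ → refl })

⊛-≈0 : ∀ {p q n} → p ⊛ q ≈ₚ [] → Degree q n → p ≈ₚ []
⊛-≈0 {p} pq≈0 q° with zero-or-degree p
... | inj₁ p≈0      = p≈0
... | inj₂ (m , p°) = contradiction pq≈0 (degree-≉0 (degree-⊛ p° q°))

neg : Poly → Poly
neg p = (- 1ℚ) · p

⊕-neg : ∀ p → p ⊕ neg p ≈ₚ []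
⊕-neg p = Polys.begin
  p ⊕ neg p             Polys.≈⟨ ⊕-congʳ (·-identityˡ p) ⟨
  1ℚ · p ⊕ (- 1ℚ) · p   Polys.≈⟨ ·-distribʳ-+ 1ℚ (- 1ℚ) p ⟨
  0ℚ · p                Polys.≈⟨ ·-zeroˡ p ⟩
  []                    Polys.∎

⊕-neg-≈0 : ∀ p q → p ⊕ neg q ≈ₚ [] → p ≈ₚ q
⊕-neg-≈0 p q p-q≈0 = Polys.begin
  p                     Polys.≈⟨ ⊕-identityʳ p ⟨
  p ⊕ []                Polys.≈⟨ ⊕-congˡ (≈ₚ-trans (⊕-comm (neg q) q) (⊕-neg q)) ⟨
  p ⊕ (neg q ⊕ q)       Polys.≈⟨ ⊕-assoc p (neg q) q ⟨
  p ⊕ neg q ⊕ q         Polys.≈⟨ ⊕-congʳ p-q≈0 ⟩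
  q                     Polys.∎

⊛-cancelʳ : ∀ {p q r n} → Degree r n → p ⊛ r ≈ₚ q ⊛ r → p ≈ₚ q
⊛-cancelʳ {p} {q} {r} r° pr≈qr = ⊕-neg-≈0 p q (⊛-≈0 (Polys.begin
  (p ⊕ neg q) ⊛ r       Polys.≈⟨ ⊛-distribʳ r p (neg q) ⟩
  p ⊛ r ⊕ neg q ⊛ r     Polys.≈⟨ ⊕-cong pr≈qr (·-⊛ (- 1ℚ) q r) ⟩
  q ⊛ r ⊕ neg (q ⊛ r)   Polys.≈⟨ ⊕-neg (q ⊛ r) ⟩
  []                    Polys.∎) r°)

1ₚ : Poly
1ₚ = 1ℚ ∷ []

1ₚ-degree : Degree 1ₚ 0
1ₚ-degree = constant-degree λ ()

unit-degree : ∀ {p} → p ∣ 1ₚ → Degree p 0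
unit-degree {p} (q ∣, qp≈1) with zero-or-degree q | zero-or-degree p
... | inj₁ q≈0 | _ = contradiction (≈ₚ-trans (≈ₚ-sym qp≈1) (⊛-cong q≈0 (≈ₚ-refl {p}))) (degree-≉0 1ₚ-degree)
... | inj₂ _ | inj₁ p≈0 = contradiction
  (≈ₚ-trans (≈ₚ-sym qp≈1) (≈ₚ-trans (⊛-congˡ q p≈0) (⊛-zeroʳ q))) (degree-≉0 1ₚ-degree)
... | inj₂ (m , q°) | inj₂ (n , p°) = subst (Degree p) (ℕ.m+n≡0⇒n≡0 m
  (degree-unique (degree-resp qp≈1 (degree-⊛ q° p°)) 1ₚ-degree)) p°

-- Horner's scheme: p = q h + r gives c + t p = (μ + t q) h + (c + t r - μ h). The bound on `r`
-- leaves the coefficient of index `n` as the only possible excess in c + t r, and `μ` is chosen to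
-- cancel it.
division : ∀ {h n} → Degree h n → ∀ p → ∃₂ λ q r → p ≈ₚ q ⊛ h ⊕ r × DegreeBelow r n
division h° [] = [] , [] , ≈ₚ-refl , below λ _ _ → refl
division {h} {n} h° (c ∷ p) with division h° p | inverse (leading≢0 h°)
... | q , r , p≈qh+r , r< | i , i*lead≡1 =
  μ ∷ q , (c ∷ r) ⊕ (- μ) · h , ≈ₚ-sym (Polys.begin
    (μ ∷ q) ⊛ h ⊕ ((c ∷ r) ⊕ (- μ) · h)
      Polys.≈⟨ ⊕-cong (≈ₚ-refl {(μ ∷ q) ⊛ h}) (⊕-comm (c ∷ r) ((- μ) · h)) ⟩
    (μ · h ⊕ (0ℚ ∷ (q ⊛ h))) ⊕ ((- μ) · h ⊕ (c ∷ r))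
      Polys.≈⟨ interchange (μ · h) (0ℚ ∷ (q ⊛ h)) ((- μ) · h) (c ∷ r) ⟩
    (μ · h ⊕ (- μ) · h) ⊕ (0ℚ + c ∷ (q ⊛ h ⊕ r))
      Polys.≈⟨ ⊕-cong
        (≈ₚ-trans (≈ₚ-sym (·-distribʳ-+ μ (- μ) h))
          (≈ₚ-trans (·-cong (ℚ.+-inverseʳ μ) (≈ₚ-refl {h})) (·-zeroˡ h)))
        (∷-cong (ℚ.+-identityˡ c) (≈ₚ-sym p≈qh+r)) ⟩
    c ∷ p Polys.∎) , below λ k n≤k → trans (coeff-⊕ (c ∷ r) ((- μ) · h) k)
      (trans (cong (λ x → coeff (c ∷ r) k + x) (coeff-· (- μ) h k)) (remainder k (ℕ.m≤n⇒m<n∨m≡n n≤k)))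
  where
  μ : ℚ
  μ = coeff (c ∷ r) n * i

  open ℚSolver.+-*-Solver
  cancel-leading : ∀ x i l → i * l ≡ 1ℚ → x + - (x * i) * l ≡ 0ℚ
  cancel-leading x i l i*l≡1 = begin
    x + - (x * i) * l     ≡⟨ solve 3 (λ x i l → x :+ (:- (x :* i)) :* l := x :+ (:- (x :* (i :* l)))) refl x i l ⟩
    x + - (x * (i * l))   ≡⟨ cong (λ y → x + - (x * y)) i*l≡1 ⟩
    x + - (x * 1ℚ)        ≡⟨ cong (λ y → x + - y) (ℚ.*-identityʳ x) ⟩
    x + - x               ≡⟨ ℚ.+-inverseʳ x ⟩
    0ℚ                    ∎
    where open ≡-Reasoning

  remainder : ∀ k → n ℕ.< k ⊎ n ≡ k → coeff (c ∷ r) k + - μ * coeff h k ≡ 0ℚ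
  remainder k (inj₂ refl) = cancel-leading (coeff (c ∷ r) n) i (coeff h n) i*lead≡1
  remainder (suc k) (inj₁ (s≤s n≤k)) = begin
    coeff r k + - μ * coeff h (suc k)
      ≡⟨ cong₂ (λ x y → x + - μ * y) (vanish r< k n≤k) (vanish (beyond h°) (suc k) (s≤s n≤k)) ⟩
    0ℚ + - μ * 0ℚ   ≡⟨ ℚ.+-identityˡ _ ⟩
    - μ * 0ℚ        ≡⟨ ℚ.*-zeroʳ (- μ) ⟩
    0ℚ              ∎
    where open ≡-Reasoning

-- Only the splitting half of irreducibility. An integer constant such as 2 is irreducible in ℤ[t]
-- but a unit in ℚ[t], so the other half does not survive the change of coefficients.
Unsplittable : Poly → Set
Unsplittable p = ∀ u v → p ≈ₚ u ⊛ v → u ∣ 1ₚ ⊎ v ∣ 1ₚ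

⊕-neg-cancel : ∀ p q → (p ⊕ q) ⊕ neg p ≈ₚ q
⊕-neg-cancel p q = Polys.begin
  (p ⊕ q) ⊕ neg p   Polys.≈⟨ ⊕-congʳ (⊕-comm p q) ⟩
  (q ⊕ p) ⊕ neg p   Polys.≈⟨ ⊕-assoc q p (neg p) ⟩
  q ⊕ (p ⊕ neg p)   Polys.≈⟨ ⊕-congˡ (⊕-neg p) ⟩
  q ⊕ []            Polys.≈⟨ ⊕-identityʳ q ⟩
  q                 Polys.∎

∣-⊕-cancelˡ : ∀ {h p q} → h ∣ p → h ∣ p ⊕ q → h ∣ q
∣-⊕-cancelˡ {h} {p} {q} (i ∣, ih≈p) (j ∣, jh≈p+q) = (j ⊕ neg i) ∣, (Polys.begin
  (j ⊕ neg i) ⊛ h       Polys.≈⟨ ⊛-distribʳ h j (neg i) ⟩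
  j ⊛ h ⊕ neg i ⊛ h     Polys.≈⟨ ⊕-cong jh≈p+q (≈ₚ-trans (·-⊛ (- 1ℚ) i h) (·-cong { - 1ℚ} refl ih≈p)) ⟩
  (p ⊕ q) ⊕ neg p       Polys.≈⟨ ⊕-neg-cancel p q ⟩
  q                     Polys.∎)

∣-⊛ʳ : ∀ {h p} q → h ∣ p → h ∣ p ⊛ q
∣-⊛ʳ {h} {p} q h∣p = ∣ʳ-respʳ-≈ (⊛-comm q p) (x∣ʳy⇒x∣ʳzy q h∣p)

unit-∣-cancel : ∀ {h u p} → u ∣ 1ₚ → h ∣ u ⊛ p → h ∣ p
unit-∣-cancel {h} {u} {p} (i ∣, iu≈1) h∣up = ∣ʳ-respʳ-≈ (Polys.begin
  i ⊛ (u ⊛ p)   Polys.≈⟨ ⊛-assoc i u p ⟨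
  (i ⊛ u) ⊛ p   Polys.≈⟨ ⊛-cong iu≈1 (≈ₚ-refl {p}) ⟩
  1ₚ ⊛ p        Polys.≈⟨ ⊛-identityˡ p ⟩
  p             Polys.∎) (x∣ʳy⇒x∣ʳzy i h∣up)

module Euclid {h d} (h° : Degree h d) (unsplittable : Unsplittable h) where

  -- Dividing h by r replaces r by a remainder of smaller degree; it cannot
  -- vanish unless r is a unit.
  small-factor : ∀ m r p → Degree r m → m ℕ.< d → h ∣ r ⊛ p → h ∣ p
  small-factor = <-rec _ λ m rec r p r° m<d h∣rp → case division r° h of λ
    { (q , s , h≈qr+s , s<) → case zero-or-degree s of λ
      { (inj₁ s≈0) → case unsplittable q r (≈ₚ-trans h≈qr+s
            (≈ₚ-trans (⊕-congˡ s≈0) (⊕-identityʳ (q ⊛ r)))) of λ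
          -- A unit `q` has degree 0, so `r` would have the degree of `h`.
          { (inj₁ q∣1) → contradiction
              (degree-unique (degree-resp (≈ₚ-sym (≈ₚ-trans h≈qr+s
                (≈ₚ-trans (⊕-congˡ s≈0) (⊕-identityʳ (q ⊛ r))))) (degree-⊛ (unit-degree q∣1) r°)) h°)
              (ℕ.<⇒≢ m<d)
          ; (inj₂ r∣1) → unit-∣-cancel r∣1 h∣rp }
      -- `h` divides both `h ⊛ p` and `q ⊛ (r ⊛ p)`, hence also their difference `s ⊛ p`.
      ; (inj₂ (m′ , s°)) → rec (below⇒< s< s°) s p s° (ℕ.<-trans (below⇒< s< s°) m<d)
          (∣-⊕-cancelˡ
            (∣ʳ-respʳ-≈ (≈ₚ-sym (⊛-assoc q r p)) (x∣ʳy⇒x∣ʳzy q h∣rp))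
            (∣ʳ-respʳ-≈ (≈ₚ-trans (⊛-cong h≈qr+s (≈ₚ-refl {p})) (⊛-distribʳ p (q ⊛ r) s))
              (∣-⊛ʳ p ∣ʳ-refl))) } }

  -- Reducing `p` modulo `h` preserves divisibility of the product by `h`; a nonzero remainder has
  -- smaller degree than `h`, so `small-factor` removes it.
  prime : ∀ p q → h ∣ p ⊛ q → h ∣ p ⊎ h ∣ q
  prime p q h∣pq with division h° p
  ... | i , r , p≈ih+r , r< with zero-or-degree r
  ...   | inj₁ r≈0 = inj₁ (i ∣, ≈ₚ-sym (≈ₚ-trans p≈ih+r
            (≈ₚ-trans (⊕-congˡ r≈0) (⊕-identityʳ (i ⊛ h)))))
  ...   | inj₂ (m , r°) = inj₂ (small-factor m r q r° (below⇒< r< r°)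
            (∣-⊕-cancelˡ (∣-⊛ʳ q (i ∣, ≈ₚ-refl))
              (∣ʳ-respʳ-≈ (≈ₚ-trans (⊛-cong p≈ih+r (≈ₚ-refl {q})) (⊛-distribʳ q (i ⊛ h) r)) h∣pq)))

-- Gauss's lemma over ℚ

-- `fromℤ` normalises a fraction, so its homomorphism laws are checked on unnormalised
-- representatives.
toℚᵘ-fromℤ : ∀ i → ℚ.toℚᵘ (fromℤ i) ≃ mkℚᵘ i 0
toℚᵘ-fromℤ i = ℚ.toℚᵘ-fromℚᵘ (mkℚᵘ i 0)

fromℤ-+ : ∀ i j → fromℤ (i ℤ.+ j) ≡ fromℤ i + fromℤ j
fromℤ-+ i j = ℚ.toℚᵘ-injective (begin
  ℚ.toℚᵘ (fromℤ (i ℤ.+ j))                    ≈⟨ toℚᵘ-fromℤ (i ℤ.+ j) ⟩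
  mkℚᵘ (i ℤ.+ j) 0                            ≈⟨ *≡* (cong (ℤ._* 1ℤ)
    (cong₂ ℤ._+_ (sym (ℤ.*-identityʳ i)) (sym (ℤ.*-identityʳ j)))) ⟩
  mkℚᵘ i 0 ℚᵘ.+ mkℚᵘ j 0                      ≈⟨ ℚᵘ.+-cong (toℚᵘ-fromℤ i) (toℚᵘ-fromℤ j) ⟨
  ℚ.toℚᵘ (fromℤ i) ℚᵘ.+ ℚ.toℚᵘ (fromℤ j)      ≈⟨ ℚ.toℚᵘ-homo-+ (fromℤ i) (fromℤ j) ⟨
  ℚ.toℚᵘ (fromℤ i + fromℤ j)                  ∎)
  where open SetoidReasoning ℚᵘ.≃-setoid

fromℤ-* : ∀ i j → fromℤ (i ℤ.* j) ≡ fromℤ i * fromℤ j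
fromℤ-* i j = ℚ.toℚᵘ-injective (begin
  ℚ.toℚᵘ (fromℤ (i ℤ.* j))                    ≈⟨ toℚᵘ-fromℤ (i ℤ.* j) ⟩
  mkℚᵘ i 0 ℚᵘ.* mkℚᵘ j 0                      ≈⟨ ℚᵘ.*-cong (toℚᵘ-fromℤ i) (toℚᵘ-fromℤ j) ⟨
  ℚ.toℚᵘ (fromℤ i) ℚᵘ.* ℚ.toℚᵘ (fromℤ j)      ≈⟨ ℚ.toℚᵘ-homo-* (fromℤ i) (fromℤ j) ⟨
  ℚ.toℚᵘ (fromℤ i * fromℤ j)                  ∎)
  where open SetoidReasoning ℚᵘ.≃-setoid

fromℤ-injective : ∀ {i j} → fromℤ i ≡ fromℤ j → i ≡ j
fromℤ-injective {i} {j} eq with ℚ.fromℚᵘ-injective {mkℚᵘ i 0} {mkℚᵘ j 0} eq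
... | *≡* i1≡j1 = ℤ.*-cancelʳ-≡ i j 1ℤ i1≡j1

fromℤ-≢0 : ∀ {i} → i ≢ 0ℤ → fromℤ i ≢ 0ℚ
fromℤ-≢0 i≢0 = i≢0 ∘ fromℤ-injective

fromℤ-↧*↥ : ∀ c → fromℤ (ℚ.↧ c) * c ≡ fromℤ (ℚ.↥ c)
fromℤ-↧*↥ c@record{} = ℚ.toℚᵘ-injective (begin
  ℚ.toℚᵘ (fromℤ (ℚ.↧ c) * c)                ≈⟨ ℚ.toℚᵘ-homo-* (fromℤ (ℚ.↧ c)) c ⟩
  ℚ.toℚᵘ (fromℤ (ℚ.↧ c)) ℚᵘ.* ℚ.toℚᵘ c      ≈⟨ ℚᵘ.*-cong (toℚᵘ-fromℤ (ℚ.↧ c)) (ℚᵘ.≃-refl {ℚ.toℚᵘ c}) ⟩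
  mkℚᵘ (ℚ.↧ c) 0 ℚᵘ.* ℚ.toℚᵘ c              ≈⟨ *≡* (trans (ℤ.*-identityʳ _)
    (trans (ℤ.*-comm (ℚ.↧ c) (ℚ.↥ c)) (cong (ℚ.↥ c ℤ.*_) (sym (ℤ.*-identityˡ (ℚ.↧ c)))))) ⟩
  mkℚᵘ (ℚ.↥ c) 0                            ≈⟨ toℚᵘ-fromℤ (ℚ.↥ c) ⟨
  ℚ.toℚᵘ (fromℤ (ℚ.↥ c))                    ∎)
  where open SetoidReasoning ℚᵘ.≃-setoid

coeff-fromℤ[t] : ∀ p n → coeff (fromℤ[t] p) n ≡ fromℤ (ℤ[t].coeff p n)
coeff-fromℤ[t] []      n       = refl
coeff-fromℤ[t] (c ∷ p) zero    = refl
coeff-fromℤ[t] (c ∷ p) (suc n) = coeff-fromℤ[t] p n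

fromℤ[t]-cong : ∀ {p q} → p ℤPoly.≈ₚ q → fromℤ[t] p ≈ₚ fromℤ[t] q
fromℤ[t]-cong {p} {q} p≈q = ⟨ (λ n → trans (coeff-fromℤ[t] p n)
  (trans (cong fromℤ (ℤPoly.coeff-≈ p≈q n)) (sym (coeff-fromℤ[t] q n)))) ⟩

fromℤ[t]-injective : ∀ {p q} → fromℤ[t] p ≈ₚ fromℤ[t] q → p ℤPoly.≈ₚ q
fromℤ[t]-injective {p} {q} p≈q = ℤPoly.⟨ (λ n → fromℤ-injective
  (trans (sym (coeff-fromℤ[t] p n)) (trans (coeff-≈ p≈q n) (coeff-fromℤ[t] q n)))) ⟩

fromℤ[t]-⊕ : ∀ p q → fromℤ[t] (p ℤ[t].⊕ q) ≡ fromℤ[t] p ⊕ fromℤ[t] q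
fromℤ[t]-⊕ []      q       = refl
fromℤ[t]-⊕ (c ∷ p) []      = refl
fromℤ[t]-⊕ (c ∷ p) (e ∷ q) = cong₂ _∷_ (fromℤ-+ c e) (fromℤ[t]-⊕ p q)

fromℤ[t]-· : ∀ c p → fromℤ[t] (c ℤPoly.· p) ≡ fromℤ c · fromℤ[t] p
fromℤ[t]-· c []      = refl
fromℤ[t]-· c (e ∷ p) = cong₂ _∷_ (fromℤ-* c e) (fromℤ[t]-· c p)

fromℤ[t]-⊛ : ∀ p q → fromℤ[t] (p ℤ[t].⊛ q) ≡ fromℤ[t] p ⊛ fromℤ[t] q
fromℤ[t]-⊛ []      q = refl
fromℤ[t]-⊛ (c ∷ p) q = trans (fromℤ[t]-⊕ (c ℤPoly.· q) (0ℤ ∷ (p ℤ[t].⊛ q)))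
  (cong₂ _⊕_ (fromℤ[t]-· c q) (cong (0ℚ ∷_) (fromℤ[t]-⊛ p q)))

-- `D` is the product of the denominators of all coefficients. Any common multiple will do, because
-- its primes are later removed one by one.
clear-denominators : ∀ p → ∃₂ λ D q → ℕ.NonZero D × fromℤ (+ D) · p ≈ₚ fromℤ[t] q
clear-denominators [] = 1 , [] , _ , ≈ₚ-refl
clear-denominators (c ∷ p) with clear-denominators p
... | D , q , D≢0 , Dp≈q =
  k ℕ.* D , (ℚ.↥ c ℤ.* + D) ∷ (+ k ℤPoly.· q) ,
  ℕ.m*n≢0 k D {{_}} {{D≢0}} , ∷-cong head (Polys.begin
    fromℤ (+ (k ℕ.* D)) · p              Polys.≈⟨ ·-cong kD (≈ₚ-refl {p}) ⟩
    (fromℤ (+ k) * fromℤ (+ D)) · p      Polys.≈⟨ ·-assoc (fromℤ (+ k)) (fromℤ (+ D)) p ⟩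
    fromℤ (+ k) · (fromℤ (+ D) · p)      Polys.≈⟨ ·-cong {fromℤ (+ k)} refl Dp≈q ⟩
    fromℤ (+ k) · fromℤ[t] q             Polys.≡⟨ fromℤ[t]-· (+ k) q ⟨
    fromℤ[t] (+ k ℤPoly.· q)             Polys.∎)
  where
  k : ℕ
  k = ℚ.↧ₙ c

  kD : fromℤ (+ (k ℕ.* D)) ≡ fromℤ (+ k) * fromℤ (+ D)
  kD = trans (cong fromℤ (ℤ.pos-* k D)) (fromℤ-* (+ k) (+ D))

  head : fromℤ (+ (k ℕ.* D)) * c ≡ fromℤ (ℚ.↥ c ℤ.* + D)
  head = begin
    fromℤ (+ (k ℕ.* D)) * c               ≡⟨ cong (_* c) kD ⟩
    fromℤ (+ k) * fromℤ (+ D) * c         ≡⟨ ℚ.*-assoc (fromℤ (+ k)) (fromℤ (+ D)) c ⟩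
    fromℤ (+ k) * (fromℤ (+ D) * c)       ≡⟨ cong (fromℤ (+ k) *_) (ℚ.*-comm (fromℤ (+ D)) c) ⟩
    fromℤ (+ k) * (c * fromℤ (+ D))       ≡⟨ ℚ.*-assoc (fromℤ (+ k)) c (fromℤ (+ D)) ⟨
    fromℤ (+ k) * c * fromℤ (+ D)         ≡⟨ cong (_* fromℤ (+ D)) (fromℤ-↧*↥ c) ⟩
    fromℤ (ℚ.↥ c) * fromℤ (+ D)           ≡⟨ fromℤ-* (ℚ.↥ c) (+ D) ⟨
    fromℤ (ℚ.↥ c ℤ.* + D)                 ∎
    where open ≡-Reasoning

unit-up-to-scalars : ∀ k m {p q} → m ≢ 0ℚ → k · p ≈ₚ m · q → q ∣ 1ₚ → p ∣ 1ₚ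
unit-up-to-scalars k m {p} {q} m≢0 kp≈mq (i ∣, iq≈1) with inverse m≢0
... | m⁻¹ , m⁻¹m≡1 = ((m⁻¹ * k) · i) ∣, (Polys.begin
  ((m⁻¹ * k) · i) ⊛ p     Polys.≈⟨ ·-⊛ (m⁻¹ * k) i p ⟩
  (m⁻¹ * k) · (i ⊛ p)     Polys.≈⟨ ·-assoc m⁻¹ k (i ⊛ p) ⟩
  m⁻¹ · (k · (i ⊛ p))     Polys.≈⟨ ·-cong {m⁻¹} refl (·-⊛ʳ k i p) ⟨
  m⁻¹ · (i ⊛ (k · p))     Polys.≈⟨ ·-cong {m⁻¹} refl (⊛-congˡ i kp≈mq) ⟩
  m⁻¹ · (i ⊛ (m · q))     Polys.≈⟨ ·-cong {m⁻¹} refl (·-⊛ʳ m i q) ⟩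
  m⁻¹ · (m · (i ⊛ q))     Polys.≈⟨ ·-assoc m⁻¹ m (i ⊛ q) ⟨
  (m⁻¹ * m) · (i ⊛ q)     Polys.≈⟨ ·-cong m⁻¹m≡1 iq≈1 ⟩
  1ℚ · 1ₚ                 Polys.≈⟨ ·-identityˡ 1ₚ ⟩
  1ₚ                      Polys.∎)

-- Clearing denominators turns a rational factorisation into one of `D * E` times `f` over ℤ.
-- Removing the primes of `D * E` leaves an integral factorisation of `f` itself, whose factors
-- differ from `u` and `v` only by nonzero rational scalars.
irreducible⇒unsplittable : ∀ {f} → IrreducibleInℤ[t] f → Unsplittable (fromℤ[t] f)
irreducible⇒unsplittable {f} f-irr u v f≈uv
  with clear-denominators u | clear-denominators v
... | D , U , D≢0 , Du≈U | E , V , E≢0 , Ev≈V =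
  Sum.map (rational-unit d u≈mu′ m≢0 Du≈U) (rational-unit e v≈nv′ n≢0 Ev≈V)
    (SemiringDefs.Irreducible.split-∣1 f-irr (ℤPoly.coeff-≈ f≈u′v′))
  where
  d e : ℚ
  d = fromℤ (+ D)
  e = fromℤ (+ E)

  DEf≈UV : + (D ℕ.* E) ℤPoly.· f ℤPoly.≈ₚ U ℤ[t].⊛ V
  DEf≈UV = fromℤ[t]-injective (Polys.begin
    fromℤ[t] (+ (D ℕ.* E) ℤPoly.· f)   Polys.≡⟨ fromℤ[t]-· (+ (D ℕ.* E)) f ⟩
    fromℤ (+ (D ℕ.* E)) · fromℤ[t] f   Polys.≈⟨ ·-cong (trans (cong fromℤ (ℤ.pos-* D E)) (fromℤ-* (+ D) (+ E))) f≈uv ⟩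
    (d * e) · (u ⊛ v)                  Polys.≈⟨ ·-assoc d e (u ⊛ v) ⟩
    d · (e · (u ⊛ v))                  Polys.≈⟨ ·-cong {d} refl (·-⊛ʳ e u v) ⟨
    d · (u ⊛ (e · v))                  Polys.≈⟨ ·-⊛ d u (e · v) ⟨
    (d · u) ⊛ (e · v)                  Polys.≈⟨ ⊛-cong Du≈U Ev≈V ⟩
    fromℤ[t] U ⊛ fromℤ[t] V            Polys.≡⟨ fromℤ[t]-⊛ U V ⟨
    fromℤ[t] (U ℤ[t].⊛ V)              Polys.∎)

  open Content.IntegralFactorisation
    (Content.integral-factorisation (D ℕ.* E) {{ℕ.m*n≢0 D E {{D≢0}} {{E≢0}}}} f U V DEf≈UV)

  rational-unit : ∀ k {m u U u′} → U ℤPoly.≈ₚ m ℤPoly.· u′ → m ≢ 0ℤ → k · u ≈ₚ fromℤ[t] U →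
    SemiringDefs._∣_ ℤ[t].polyRawSemiring u′ (1ℤ ∷ []) → u ∣ 1ₚ
  rational-unit k {m = m} {u′ = u′} U≈mu′ m≢0 ku≈U (q ∣, qu′≈1) = unit-up-to-scalars k (fromℤ m) (fromℤ-≢0 m≢0)
    (≈ₚ-trans ku≈U (Polys.begin
      fromℤ[t] _                 Polys.≈⟨ fromℤ[t]-cong U≈mu′ ⟩
      fromℤ[t] (m ℤPoly.· u′)    Polys.≡⟨ fromℤ[t]-· m u′ ⟩
      fromℤ m · fromℤ[t] u′      Polys.∎))
    (fromℤ[t] q ∣, (Polys.begin
      fromℤ[t] q ⊛ fromℤ[t] u′   Polys.≡⟨ fromℤ[t]-⊛ q u′ ⟨
      fromℤ[t] (q ℤ[t].⊛ u′)     Polys.≈⟨ fromℤ[t]-cong ℤPoly.⟨ qu′≈1 ⟩ ⟩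
      1ₚ                         Polys.∎))

-- ℚ[t] as a quadratic extension of ℚ[g]

module SemiringIdentities {a ℓ} (S : CommutativeSemiring a ℓ) where

  open CommutativeSemiring S hiding (refl; sym; trans) renaming (_+_ to _⊹_; _*_ to _✶_)
  private module ≈ = CommutativeSemiring S
  open import Algebra.Solver.Ring.NaturalCoefficients.Default S
  open SetoidReasoning setoid

  product-in-basis : ∀ {T δ} r s u v → T ✶ T ≈ δ →
    (r ⊹ T ✶ s) ✶ (u ⊹ T ✶ v) ≈ (r ✶ u ⊹ δ ✶ (s ✶ v)) ⊹ T ✶ (r ✶ v ⊹ s ✶ u)
  product-in-basis {T} {δ} r s u v TT≈δ = begin
    (r ⊹ T ✶ s) ✶ (u ⊹ T ✶ v)
      ≈⟨ solve 5 (λ T r s u v → (r :+ T :* s) :* (u :+ T :* v)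
           := (r :* u :+ (T :* T) :* (s :* v)) :+ T :* (r :* v :+ s :* u)) ≈.refl T r s u v ⟩
    (r ✶ u ⊹ (T ✶ T) ✶ (s ✶ v)) ⊹ T ✶ (r ✶ v ⊹ s ✶ u)
      ≈⟨ +-congʳ (+-congˡ (*-congʳ TT≈δ)) ⟩
    (r ✶ u ⊹ δ ✶ (s ✶ v)) ⊹ T ✶ (r ✶ v ⊹ s ✶ u) ∎

  private
    absorb : ∀ {x z} → z ≈ 0# → ∀ y → x ≈ x ⊹ z ✶ y
    absorb {x} z≈0 y = ≈.sym (≈.trans (+-congˡ (≈.trans (*-congʳ z≈0) (zeroˡ y))) (+-identityʳ x))

  -- Brahmagupta's identity for r² - δ s², with `μ` in the place of -δ. The two sides agree only
  -- modulo `μ ⊹ δ`, so a multiple of this zero element is added to each side to obtain an identity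
  -- with natural coefficients.
  norm-multiplicative : ∀ {δ μ} r s u v → μ ⊹ δ ≈ 0# →
    (r ✶ r ⊹ μ ✶ (s ✶ s)) ✶ (u ✶ u ⊹ μ ✶ (v ✶ v)) ≈
    (r ✶ u ⊹ δ ✶ (s ✶ v)) ✶ (r ✶ u ⊹ δ ✶ (s ✶ v)) ⊹ μ ✶ ((r ✶ v ⊹ s ✶ u) ✶ (r ✶ v ⊹ s ✶ u))
  norm-multiplicative {δ} {μ} r s u v μ+δ≈0 = begin
    (r ✶ r ⊹ μ ✶ (s ✶ s)) ✶ (u ✶ u ⊹ μ ✶ (v ✶ v))
      ≈⟨ absorb μ+δ≈0 _ ⟩
    (r ✶ r ⊹ μ ✶ (s ✶ s)) ✶ (u ✶ u ⊹ μ ✶ (v ✶ v))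
      ⊹ (μ ⊹ δ) ✶ (δ ✶ (s ✶ s ✶ (v ✶ v)) ⊹ (r ✶ s ✶ (u ✶ v) ⊹ r ✶ s ✶ (u ✶ v)))
      ≈⟨ solve 6 (λ δ μ r s u v →
           (r :* r :+ μ :* (s :* s)) :* (u :* u :+ μ :* (v :* v))
             :+ (μ :+ δ) :* (δ :* (s :* s :* (v :* v)) :+ (r :* s :* (u :* v) :+ r :* s :* (u :* v)))
           := ((r :* u :+ δ :* (s :* v)) :* (r :* u :+ δ :* (s :* v))
                 :+ μ :* ((r :* v :+ s :* u) :* (r :* v :+ s :* u)))
             :+ (μ :+ δ) :* (μ :* (s :* s :* (v :* v)))) ≈.refl δ μ r s u v ⟩
    ((r ✶ u ⊹ δ ✶ (s ✶ v)) ✶ (r ✶ u ⊹ δ ✶ (s ✶ v)) ⊹ μ ✶ ((r ✶ v ⊹ s ✶ u) ✶ (r ✶ v ⊹ s ✶ u)))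
      ⊹ (μ ⊹ δ) ✶ (μ ✶ (s ✶ s ✶ (v ✶ v)))
      ≈⟨ absorb μ+δ≈0 _ ⟨
    (r ✶ u ⊹ δ ✶ (s ✶ v)) ✶ (r ✶ u ⊹ δ ✶ (s ✶ v)) ⊹ μ ✶ ((r ✶ v ⊹ s ✶ u) ✶ (r ✶ v ⊹ s ✶ u)) ∎

  -- The difference of two squares, with `s′` in the place of -s; multiples of `s ⊹ s′` and `μ ⊹ δ`
  -- again stand in for subtraction.
  conjugate-product : ∀ {T δ μ s s′} r → T ✶ T ≈ δ → μ ⊹ δ ≈ 0# → s ⊹ s′ ≈ 0# →
    (r ⊹ T ✶ s) ✶ (r ⊹ T ✶ s′) ≈ r ✶ r ⊹ μ ✶ (s ✶ s)
  conjugate-product {T} {δ} {μ} {s} {s′} r TT≈δ μ+δ≈0 s+s′≈0 = begin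
    (r ⊹ T ✶ s) ✶ (r ⊹ T ✶ s′)
      ≈⟨ solve 4 (λ T r s s′ → (r :+ T :* s) :* (r :+ T :* s′)
           := (r :* r :+ (T :* T) :* (s :* s′)) :+ (s :+ s′) :* (T :* r)) ≈.refl T r s s′ ⟩
    (r ✶ r ⊹ (T ✶ T) ✶ (s ✶ s′)) ⊹ (s ⊹ s′) ✶ (T ✶ r)   ≈⟨ absorb s+s′≈0 _ ⟨
    r ✶ r ⊹ (T ✶ T) ✶ (s ✶ s′)                           ≈⟨ +-congˡ (*-congʳ TT≈δ) ⟩
    r ✶ r ⊹ δ ✶ (s ✶ s′)                                 ≈⟨ absorb μ+δ≈0 _ ⟩
    (r ✶ r ⊹ δ ✶ (s ✶ s′)) ⊹ (μ ⊹ δ) ✶ (s ✶ s)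
      ≈⟨ solve 5 (λ δ μ r s s′ → (r :* r :+ δ :* (s :* s′)) :+ (μ :+ δ) :* (s :* s)
           := (r :* r :+ μ :* (s :* s)) :+ (s :+ s′) :* (δ :* s)) ≈.refl δ μ r s s′ ⟩
    (r ✶ r ⊹ μ ✶ (s ✶ s)) ⊹ (s ⊹ s′) ✶ (δ ✶ s)           ≈⟨ absorb s+s′≈0 _ ⟨
    r ✶ r ⊹ μ ✶ (s ✶ s)                                  ∎

open SemiringIdentities polySemiring

-- The degrees of `E r` and `O s` are even and odd, so they never tie and one term dominates. This
-- serves twice: for coordinates, where `E` and `O` are composition with `g` and its multiple by
-- `T`, and for the norm, where they are the square and its multiple by `μ`.
parity-split : (E O : Poly → Poly) →
  (∀ {p} → p ≈ₚ [] → E p ≈ₚ []) → (∀ {p} → p ≈ₚ [] → O p ≈ₚ []) →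
  (∀ {p n} → Degree p n → Degree (E p) (n ℕ.+ n)) →
  (∀ {p n} → Degree p n → Degree (O p) (suc (n ℕ.+ n))) → ∀ r s →
  (r ≈ₚ [] × s ≈ₚ []) ⊎
  (∃[ i ] Degree r i × DegreeBelow (O s) (i ℕ.+ i)) ⊎
  (∃[ j ] Degree s j × DegreeBelow (E r) (suc (j ℕ.+ j)))
parity-split E O E-0 O-0 E° O° r s with zero-or-degree r | zero-or-degree s
... | inj₁ r≈0      | inj₁ s≈0      = inj₁ (r≈0 , s≈0)
... | inj₁ r≈0      | inj₂ (j , s°) = inj₂ (inj₂ (j , s° , below-resp (≈ₚ-sym (E-0 r≈0)) (below λ _ _ → refl)))
... | inj₂ (i , r°) | inj₁ s≈0      = inj₂ (inj₁ (i , r° , below-resp (≈ₚ-sym (O-0 s≈0)) (below λ _ _ → refl)))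
... | inj₂ (i , r°) | inj₂ (j , s°) with i ℕ.≤? j
...   | yes i≤j = inj₂ (inj₂ (j , s° , below-≤ (s≤s (ℕ.+-mono-≤ i≤j i≤j)) (beyond (E° r°))))
-- From j < i follows 2j + 2 ≤ 2i, and 2j + 2 is the strict bound belonging to the degree 2j + 1 of
-- `O s`.
...   | no i≰j = inj₂ (inj₁ (i , r° , below-≤
  (ℕ.≤-trans (ℕ.≤-reflexive (cong suc (sym (ℕ.+-suc j j)))) (ℕ.+-mono-≤ (ℕ.≰⇒> i≰j) (ℕ.≰⇒> i≰j)))
  (beyond (O° s°))))

compose-degree : ∀ {g} → Degree g 2 → ∀ {p n} → Degree p n → Degree (compose p g) (n ℕ.+ n)
compose-degree g° {[]} p° = contradiction refl (leading≢0 p°)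
compose-degree {g} g° {c ∷ p} {zero} p° = degree-resp (Polys.begin
  c ∷ []                            Polys.≈⟨ ⊕-identityʳ (c ∷ []) ⟨
  (c ∷ []) ⊕ []                     Polys.≈⟨ ⊕-cong (≈ₚ-refl {c ∷ []}) (≈ₚ-trans
    (⊛-congˡ g (Compose.evaluate-≈0 g {p} (below-zero (below-tail (beyond p°))))) (⊛-zeroʳ g)) ⟨
  (c ∷ []) ⊕ g ⊛ compose p g        Polys.∎) (constant-degree (leading≢0 p°))
compose-degree {g} g° {c ∷ p} {suc n} p° = degree-resp
  (⊕-comm (g ⊛ compose p g) (c ∷ []))
  (degree-⊕ (subst (Degree (g ⊛ compose p g)) (cong suc (sym (ℕ.+-suc n n)))
      (degree-⊛ g° (compose-degree g° {p} (degree (leading≢0 p°) (below-tail (beyond p°))))))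
    (below λ { (suc k) _ → refl }))

open import Algebra.Properties.Semiring.Exp (CommutativeRing.semiring ℚ.+-*-commutativeRing)
  using (^-homo-*)

⊛-≈[] : ∀ p {q} → q ≈ₚ [] → p ⊛ q ≈ₚ []
⊛-≈[] p q≈0 = ≈ₚ-trans (⊛-congˡ p q≈0) (⊛-zeroʳ p)

neg-≢0 : ∀ {x} → x ≢ 0ℚ → - x ≢ 0ℚ
neg-≢0 {x} x≢0 -x≡0 = x≢0 (ℚ.neg-injective {x} {0ℚ} -x≡0)

^-≢0 : ∀ {x} → x ≢ 0ℚ → ∀ n → x ^ℚ n ≢ 0ℚ
^-≢0 x≢0 zero    = λ ()
^-≢0 x≢0 (suc n) = *-≢0 x≢0 (^-≢0 x≢0 n)

-- g = a (t + β)² + e, T = t + β, T² = δ(g) and μ = - δ.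
record CompletedSquare (g : Poly) : Set where
  field
    e β       : ℚ
    T δ μ     : Poly
    T-degree  : Degree T 1
    μ-degree  : Degree μ 1
    μ-leading : - coeff μ 1 * coeff g 2 ≡ 1ℚ
    μ-root    : eval μ e ≡ 0ℚ
    μ⊕δ≈0     : μ ⊕ δ ≈ₚ []
    T⊛T≈δ∘g   : T ⊛ T ≈ₚ compose δ g
    T⊛-shift  : ∀ p → T ⊛ p ⊕ (- β) · p ≈ₚ 0ℚ ∷ p

module _ {g : Poly} (g° : Degree g 2) where

  private
    a b c a⁻¹ β e : ℚ
    a = coeff g 2
    b = coeff g 1
    c = coeff g 0
    a⁻¹ = proj₁ (inverse (leading≢0 g°))
    β = ℚ.½ * (b * a⁻¹)
    e = c + - (a * (β * β))

    T δ μ : Poly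
    T = β ∷ 1ℚ ∷ []
    δ = - e * a⁻¹ ∷ a⁻¹ ∷ []
    μ = e * a⁻¹ ∷ - a⁻¹ ∷ []

    a⁻¹a≡1 : a⁻¹ * a ≡ 1ℚ
    a⁻¹a≡1 = proj₂ (inverse (leading≢0 g°))

    a⁻¹≢0 : a⁻¹ ≢ 0ℚ
    a⁻¹≢0 a⁻¹≡0 = contradiction (trans (sym a⁻¹a≡1) (trans (cong (_* a) a⁻¹≡0) (ℚ.*-zeroˡ a))) λ ()

    open ℚSolver.+-*-Solver using (solve; _:+_; _:*_; :-_; _:=_; con)

    μ⊕δ≈0 : μ ⊕ δ ≈ₚ []
    μ⊕δ≈0 = ⟨ (λ { 0 → solve 2 (λ e i → e :* i :+ (:- e) :* i := con 0ℚ) refl e a⁻¹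
                 ; 1 → ℚ.+-inverseˡ a⁻¹
                 ; (suc (suc n)) → refl }) ⟩

    constant-term : ∀ a⁻¹ a c β → a⁻¹ * a ≡ 1ℚ →
      β * β + 0ℚ ≡ - (c + - (a * (β * β))) * a⁻¹ + a⁻¹ * c
    constant-term a⁻¹ a c β a⁻¹a≡1 = sym (begin
      - (c + - (a * (β * β))) * a⁻¹ + a⁻¹ * c
        ≡⟨ solve 4 (λ i a c β → (:- (c :+ (:- (a :* (β :* β))))) :* i :+ i :* c := (i :* a) :* (β :* β))
             refl a⁻¹ a c β ⟩
      (a⁻¹ * a) * (β * β)   ≡⟨ cong (_* (β * β)) a⁻¹a≡1 ⟩
      1ℚ * (β * β)          ≡⟨ ℚ.*-identityˡ (β * β) ⟩
      β * β                 ≡⟨ ℚ.+-identityʳ (β * β) ⟨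
      β * β + 0ℚ            ∎)
      where open ≡-Reasoning

    coeff-T⊛T : ∀ n → coeff (T ⊛ T) n ≡ coeff (- e * a⁻¹ ∷ []) n + a⁻¹ * coeff g n
    coeff-T⊛T 0 = constant-term a⁻¹ a c β a⁻¹a≡1
    coeff-T⊛T 1 = solve 2 (λ i b →
      (con ℚ.½ :* (b :* i)) :* con 1ℚ :+ (con 1ℚ :* (con ℚ.½ :* (b :* i)) :+ con 0ℚ)
        := con 0ℚ :+ i :* b) refl a⁻¹ b
    coeff-T⊛T 2 = sym (trans (ℚ.+-identityˡ _) a⁻¹a≡1)
    coeff-T⊛T (suc (suc (suc n))) = sym (trans (ℚ.+-identityˡ _)
      (trans (cong (a⁻¹ *_) (vanish (beyond g°) (suc (suc (suc n))) (s≤s (s≤s (s≤s z≤n)))))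
             (ℚ.*-zeroʳ a⁻¹)))

    T⊛T≈δ∘g : T ⊛ T ≈ₚ compose δ g
    T⊛T≈δ∘g = Polys.begin
      T ⊛ T                             Polys.≈⟨ ⟨ (λ n → trans (coeff-T⊛T n) (sym
        (trans (coeff-⊕ (- e * a⁻¹ ∷ []) (a⁻¹ · g) n)
          (cong (λ x → coeff (- e * a⁻¹ ∷ []) n + x) (coeff-· a⁻¹ g n))))) ⟩ ⟩
      (- e * a⁻¹ ∷ []) ⊕ a⁻¹ · g        Polys.≈⟨ ⊕-cong (≈ₚ-refl { - e * a⁻¹ ∷ []}) (Polys.begin
        g ⊛ ((a⁻¹ ∷ []) ⊕ g ⊛ [])         Polys.≈⟨ ⊛-congˡ g (⊕-cong (≈ₚ-refl {a⁻¹ ∷ []}) (⊛-zeroʳ g)) ⟩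
        g ⊛ (a⁻¹ ∷ [])                    Polys.≈⟨ ⊛-comm g (a⁻¹ ∷ []) ⟩
        (a⁻¹ ∷ []) ⊛ g                    Polys.≈⟨ [ a⁻¹ ]⊛ g ⟩
        a⁻¹ · g                           Polys.∎) ⟨
      compose δ g                       Polys.∎

    T⊛-shift : ∀ p → T ⊛ p ⊕ (- β) · p ≈ₚ 0ℚ ∷ p
    T⊛-shift p = Polys.begin
      (β · p ⊕ (0ℚ ∷ 1ₚ ⊛ p)) ⊕ (- β) · p
        Polys.≈⟨ ⊕-cong (⊕-comm (β · p) (0ℚ ∷ 1ₚ ⊛ p)) (≈ₚ-refl {(- β) · p}) ⟩
      ((0ℚ ∷ 1ₚ ⊛ p) ⊕ β · p) ⊕ (- β) · p
        Polys.≈⟨ ⊕-assoc (0ℚ ∷ 1ₚ ⊛ p) (β · p) ((- β) · p) ⟩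
      (0ℚ ∷ 1ₚ ⊛ p) ⊕ (β · p ⊕ (- β) · p)
        Polys.≈⟨ ⊕-cong (∷-cong refl (⊛-identityˡ p)) (≈ₚ-trans (≈ₚ-sym (·-distribʳ-+ β (- β) p))
          (≈ₚ-trans (·-cong (ℚ.+-inverseʳ β) (≈ₚ-refl {p})) (·-zeroˡ p))) ⟩
      (0ℚ ∷ p) ⊕ []   Polys.≈⟨ ⊕-identityʳ (0ℚ ∷ p) ⟩
      0ℚ ∷ p          Polys.∎

  complete-square : CompletedSquare g
  complete-square = record
    { e = e ; β = β ; T = T ; δ = δ ; μ = μ
    ; T-degree = linear-degree λ ()
    ; μ-degree = linear-degree (neg-≢0 a⁻¹≢0)
    ; μ-leading = trans (solve 2 (λ i a → (:- (:- i)) :* a := i :* a) refl a⁻¹ a) a⁻¹a≡1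
    ; μ-root = solve 2 (λ e i → e :* i :+ e :* ((:- i) :+ e :* con 0ℚ) := con 0ℚ) refl e a⁻¹
    ; μ⊕δ≈0 = μ⊕δ≈0
    ; T⊛T≈δ∘g = T⊛T≈δ∘g
    ; T⊛-shift = T⊛-shift }

-- Cancelling one `f` from (w f) n = f f leaves f = w n, to which irreducibility applies.
square-cancel : ∀ {f d} → Degree f d → Unsplittable f → ∀ w m n → m ≈ₚ w ⊛ f → m ⊛ n ≈ₚ f ⊛ f →
  w ∣ 1ₚ ⊎ n ∣ 1ₚ
square-cancel {f} f° unsplittable w m n m≈wf mn≈ff = unsplittable w n
  (⊛-cancelʳ f° (Polys.begin
    f ⊛ f         Polys.≈⟨ mn≈ff ⟨
    m ⊛ n         Polys.≈⟨ ⊛-cong m≈wf (≈ₚ-refl {n}) ⟩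
    (w ⊛ f) ⊛ n   Polys.≈⟨ ⊛-assoc w f n ⟩
    w ⊛ (f ⊛ n)   Polys.≈⟨ ⊛-congˡ w (⊛-comm f n) ⟩
    w ⊛ (n ⊛ f)   Polys.≈⟨ ⊛-assoc w n f ⟨
    (w ⊛ n) ⊛ f   Polys.∎))

module QuadraticBasis {g : Poly} (g° : Degree g 2) (completedSquare : CompletedSquare g) where

  open CompletedSquare completedSquare
  open Compose g using () renaming
    ( evaluate-≈0 to ∘g-≈0; evaluate-cong to ∘g-cong; evaluate-⊕ to ∘g-⊕
    ; evaluate-· to ∘g-·; evaluate-⊛ to ∘g-⊛ )
  open ℚSolver.+-*-Solver using (solve; _:*_; :-_; _:=_)

  private
    a : ℚ
    a = coeff g 2

    -a≢0 : - a ≢ 0ℚ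
    -a≢0 = neg-≢0 (leading≢0 g°)

  Φ : Poly → Poly → Poly
  Φ r s = compose r g ⊕ T ⊛ compose s g

  ∘g-degree : ∀ p {n} → Degree p n → Degree (compose p g) (n ℕ.+ n)
  ∘g-degree p = compose-degree g° {p}

  T⊛∘g-degree : ∀ p {n} → Degree p n → Degree (T ⊛ compose p g) (suc (n ℕ.+ n))
  T⊛∘g-degree p p° = degree-⊛ {T} {compose p g} T-degree (∘g-degree p p°)

  T⊛∘g-≈0 : ∀ p → p ≈ₚ [] → T ⊛ compose p g ≈ₚ []
  T⊛∘g-≈0 p p≈0 = ⊛-≈[] T (∘g-≈0 {p} p≈0)

  even-dominates : ∀ r s {i} → Degree r i → DegreeBelow (T ⊛ compose s g) (i ℕ.+ i) → ¬ Φ r s ≈ₚ []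
  even-dominates r s r° s< =
    degree-≉0 {Φ r s} (degree-⊕ {compose r g} {T ⊛ compose s g} (∘g-degree r r°) s<)

  odd-dominates : ∀ r s {j} → Degree s j → DegreeBelow (compose r g) (suc (j ℕ.+ j)) → ¬ Φ r s ≈ₚ []
  odd-dominates r s s° r< Φ≈0 = degree-≉0 {T ⊛ compose s g ⊕ compose r g}
    (degree-⊕ {T ⊛ compose s g} {compose r g} (T⊛∘g-degree s s°) r<)
    (≈ₚ-trans (⊕-comm (T ⊛ compose s g) (compose r g)) Φ≈0)

  -- Whichever of the two terms dominates keeps its leading coefficient in the sum, so a vanishing
  -- sum leaves only zero coordinates.
  Φ-≈0 : ∀ r s → Φ r s ≈ₚ [] → r ≈ₚ [] × s ≈ₚ []
  Φ-≈0 r s Φ≈0 = [ (λ r,s≈0 → r,s≈0) , [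
    (λ { (i , r° , s<) → contradiction Φ≈0 (even-dominates r s r° s<) }) ,
    (λ { (j , s° , r<) → contradiction Φ≈0 (odd-dominates r s s° r<) }) ]′ ]′
    (parity-split (λ p → compose p g) (λ p → T ⊛ compose p g)
      (λ {p} → ∘g-≈0 {p}) (λ {p} → T⊛∘g-≈0 p) (λ {p} → ∘g-degree p) (λ {p} → T⊛∘g-degree p) r s)

  Φ-⊕ : ∀ r s r′ s′ → Φ (r ⊕ r′) (s ⊕ s′) ≈ₚ Φ r s ⊕ Φ r′ s′
  Φ-⊕ r s r′ s′ = Polys.begin
    compose (r ⊕ r′) g ⊕ T ⊛ compose (s ⊕ s′) g
      Polys.≈⟨ ⊕-cong (∘g-⊕ r r′) (≈ₚ-trans (⊛-congˡ T (∘g-⊕ s s′)) (⊛-distribˡ T (compose s g) (compose s′ g))) ⟩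
    (compose r g ⊕ compose r′ g) ⊕ (T ⊛ compose s g ⊕ T ⊛ compose s′ g)
      Polys.≈⟨ interchange (compose r g) (compose r′ g) (T ⊛ compose s g) (T ⊛ compose s′ g) ⟩
    Φ r s ⊕ Φ r′ s′ Polys.∎

  Φ-· : ∀ k r s → Φ (k · r) (k · s) ≈ₚ k · Φ r s
  Φ-· k r s = Polys.begin
    compose (k · r) g ⊕ T ⊛ compose (k · s) g
      Polys.≈⟨ ⊕-cong (≈ₚ-trans (∘g-· k r) ([ k ]⊛ (compose r g)))
        (≈ₚ-trans (⊛-congˡ T (≈ₚ-trans (∘g-· k s) ([ k ]⊛ (compose s g)))) (·-⊛ʳ k T (compose s g))) ⟩
    k · compose r g ⊕ k · (T ⊛ compose s g)
      Polys.≈⟨ ·-distribˡ-⊕ k (compose r g) (T ⊛ compose s g) ⟨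
    k · Φ r s Polys.∎

  Φ-injective : ∀ r s r′ s′ → Φ r s ≈ₚ Φ r′ s′ → r ≈ₚ r′ × s ≈ₚ s′
  Φ-injective r s r′ s′ Φ≈Φ′ =
    let r-r′≈0 , s-s′≈0 = Φ-≈0 (r ⊕ neg r′) (s ⊕ neg s′) (Polys.begin
          Φ (r ⊕ neg r′) (s ⊕ neg s′)     Polys.≈⟨ Φ-⊕ r s (neg r′) (neg s′) ⟩
          Φ r s ⊕ Φ (neg r′) (neg s′)     Polys.≈⟨ ⊕-cong Φ≈Φ′ (Φ-· (- 1ℚ) r′ s′) ⟩
          Φ r′ s′ ⊕ neg (Φ r′ s′)         Polys.≈⟨ ⊕-neg (Φ r′ s′) ⟩
          []                              Polys.∎)
    in ⊕-neg-≈0 r r′ r-r′≈0 , ⊕-neg-≈0 s s′ s-s′≈0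

  Φ-⊛ : ∀ r s u v → Φ r s ⊛ Φ u v ≈ₚ Φ (r ⊛ u ⊕ δ ⊛ (s ⊛ v)) (r ⊛ v ⊕ s ⊛ u)
  Φ-⊛ r s u v = Polys.begin
    Φ r s ⊛ Φ u v
      Polys.≈⟨ product-in-basis {T} {compose δ g} (compose r g) (compose s g) (compose u g) (compose v g) T⊛T≈δ∘g ⟩
    (compose r g ⊛ compose u g ⊕ compose δ g ⊛ (compose s g ⊛ compose v g))
      ⊕ T ⊛ (compose r g ⊛ compose v g ⊕ compose s g ⊛ compose u g)
      Polys.≈⟨ ⊕-cong
        (≈ₚ-trans (∘g-⊕ (r ⊛ u) (δ ⊛ (s ⊛ v))) (⊕-cong (∘g-⊛ r u)
          (≈ₚ-trans (∘g-⊛ δ (s ⊛ v)) (⊛-congˡ (compose δ g) (∘g-⊛ s v)))))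
        (⊛-congˡ T (≈ₚ-trans (∘g-⊕ (r ⊛ v) (s ⊛ u)) (⊕-cong (∘g-⊛ r v) (∘g-⊛ s u)))) ⟨
    Φ (r ⊛ u ⊕ δ ⊛ (s ⊛ v)) (r ⊛ v ⊕ s ⊛ u) Polys.∎

  Φ-T : ∀ r s → Φ (δ ⊛ s) r ≈ₚ T ⊛ Φ r s
  Φ-T r s = Polys.begin
    compose (δ ⊛ s) g ⊕ T ⊛ R     Polys.≈⟨ ⊕-congʳ (∘g-⊛ δ s) ⟩
    compose δ g ⊛ S ⊕ T ⊛ R       Polys.≈⟨ ⊕-congʳ (⊛-cong T⊛T≈δ∘g (≈ₚ-refl {S})) ⟨
    (T ⊛ T) ⊛ S ⊕ T ⊛ R           Polys.≈⟨ ⊕-comm ((T ⊛ T) ⊛ S) (T ⊛ R) ⟩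
    T ⊛ R ⊕ (T ⊛ T) ⊛ S           Polys.≈⟨ ⊕-cong (≈ₚ-refl {T ⊛ R}) (⊛-assoc T T S) ⟩
    T ⊛ R ⊕ T ⊛ (T ⊛ S)           Polys.≈⟨ ⊛-distribˡ T R (T ⊛ S) ⟨
    T ⊛ Φ r s                     Polys.∎
    where
    R S : Poly
    R = compose r g
    S = compose s g

  -- Horner's scheme in coordinates, with t = T - β: multiplication by `T` takes (r, s) to (δ s, r)
  -- by `Φ-T`, and `T⊛-shift` subtracts the multiple by `β`.
  Φ-surjective : ∀ u → ∃₂ λ r s → u ≈ₚ Φ r s
  Φ-surjective [] = [] , [] , ≈ₚ-sym (⊛-zeroʳ T)
  Φ-surjective (k ∷ u) with Φ-surjective u
  ... | r , s , u≈Φrs = (k ∷ []) ⊕ (δ ⊛ s ⊕ (- β) · r) , r ⊕ (- β) · s , ≈ₚ-sym (Polys.begin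
    Φ ((k ∷ []) ⊕ (δ ⊛ s ⊕ (- β) · r)) ([] ⊕ (r ⊕ (- β) · s))
      Polys.≈⟨ Φ-⊕ (k ∷ []) [] (δ ⊛ s ⊕ (- β) · r) (r ⊕ (- β) · s) ⟩
    Φ (k ∷ []) [] ⊕ Φ (δ ⊛ s ⊕ (- β) · r) (r ⊕ (- β) · s)
      Polys.≈⟨ ⊕-cong constant (≈ₚ-trans (Φ-⊕ (δ ⊛ s) r ((- β) · r) ((- β) · s))
                 (⊕-cong (Φ-T r s) (Φ-· (- β) r s))) ⟩
    (k ∷ []) ⊕ (T ⊛ Φ r s ⊕ (- β) · Φ r s)
      Polys.≈⟨ ⊕-cong (≈ₚ-refl {k ∷ []}) (T⊛-shift (Φ r s)) ⟩
    (k ∷ []) ⊕ (0ℚ ∷ Φ r s)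
      Polys.≈⟨ ∷-cong (ℚ.+-identityʳ k) (≈ₚ-sym u≈Φrs) ⟩
    k ∷ u Polys.∎)
    where
    constant : Φ (k ∷ []) [] ≈ₚ k ∷ []
    constant = Polys.begin
      ((k ∷ []) ⊕ g ⊛ []) ⊕ T ⊛ []   Polys.≈⟨ ⊕-cong (⊕-cong (≈ₚ-refl {k ∷ []}) (⊛-zeroʳ g)) (⊛-zeroʳ T) ⟩
      k ∷ []                         Polys.∎

  -- The norm of an element and its leading coefficient

  Norm : Poly → Poly → Poly
  Norm r s = r ⊛ r ⊕ μ ⊛ (s ⊛ s)

  Norm-cong : ∀ {r s r′ s′} → r ≈ₚ r′ → s ≈ₚ s′ → Norm r s ≈ₚ Norm r′ s′
  Norm-cong r≈ s≈ = ⊕-cong (⊛-cong r≈ r≈) (⊛-congˡ μ (⊛-cong s≈ s≈))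

  -- Composed with `g`, the norm is the element times its conjugate `Φ r (neg s)`. An inverse `k` of
  -- the norm therefore yields the inverse k(g) times the conjugate.
  Norm-unit : ∀ r s → Norm r s ∣ 1ₚ → Φ r s ∣ 1ₚ
  Norm-unit r s (k ∣, kN≈1) = (compose k g ⊛ Φ r (neg s)) ∣, (Polys.begin
    (compose k g ⊛ Φ r (neg s)) ⊛ Φ r s
      Polys.≈⟨ ⊛-assoc (compose k g) (Φ r (neg s)) (Φ r s) ⟩
    compose k g ⊛ (Φ r (neg s) ⊛ Φ r s)
      Polys.≈⟨ ⊛-congˡ (compose k g) (⊛-comm (Φ r (neg s)) (Φ r s)) ⟩
    compose k g ⊛ (Φ r s ⊛ Φ r (neg s))
      Polys.≈⟨ ⊛-congˡ (compose k g) (conjugate-product {T} {compose δ g} {compose μ g} {compose s g} {compose (neg s) g} (compose r g) T⊛T≈δ∘g μ+δ∘g≈0 s+-s∘g≈0) ⟩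
    compose k g ⊛ (compose r g ⊛ compose r g ⊕ compose μ g ⊛ (compose s g ⊛ compose s g))
      Polys.≈⟨ ⊛-congˡ (compose k g) (≈ₚ-trans (∘g-⊕ (r ⊛ r) (μ ⊛ (s ⊛ s)))
        (⊕-cong (∘g-⊛ r r) (≈ₚ-trans (∘g-⊛ μ (s ⊛ s)) (⊛-congˡ (compose μ g) (∘g-⊛ s s))))) ⟨
    compose k g ⊛ compose (Norm r s) g
      Polys.≈⟨ ∘g-⊛ k (Norm r s) ⟨
    compose (k ⊛ Norm r s) g
      Polys.≈⟨ ∘g-cong {k ⊛ Norm r s} {1ₚ} kN≈1 ⟩
    compose 1ₚ g
      Polys.≈⟨ ⊕-cong (≈ₚ-refl {1ₚ}) (⊛-zeroʳ g) ⟩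
    1ₚ Polys.∎)
    where
    μ+δ∘g≈0 : compose μ g ⊕ compose δ g ≈ₚ []
    μ+δ∘g≈0 = ≈ₚ-trans (≈ₚ-sym (∘g-⊕ μ δ)) (∘g-≈0 {μ ⊕ δ} μ⊕δ≈0)

    s+-s∘g≈0 : compose s g ⊕ compose (neg s) g ≈ₚ []
    s+-s∘g≈0 = ≈ₚ-trans (≈ₚ-sym (∘g-⊕ s (neg s))) (∘g-≈0 {s ⊕ neg s} (⊕-neg s))

  -- f(g) has coordinates (f, 0), whose norm is f². Uniqueness of coordinates identifies them with
  -- those of the product, and the norm is multiplicative.
  norm-product : ∀ f r s x y → compose f g ≈ₚ Φ r s ⊛ Φ x y → Norm r s ⊛ Norm x y ≈ₚ f ⊛ f
  norm-product f r s x y f∘g≈ΦΦ = Polys.begin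
    Norm r s ⊛ Norm x y
      Polys.≈⟨ norm-multiplicative {δ} {μ} r s x y μ⊕δ≈0 ⟩
    Norm X Y       Polys.≈⟨ Norm-cong {X} {Y} {f} {[]} (proj₁ X≈f,Y≈0) (proj₂ X≈f,Y≈0) ⟩
    f ⊛ f ⊕ μ ⊛ []   Polys.≈⟨ ⊕-cong (≈ₚ-refl {f ⊛ f}) (⊛-zeroʳ μ) ⟩
    f ⊛ f ⊕ []       Polys.≈⟨ ⊕-identityʳ (f ⊛ f) ⟩
    f ⊛ f            Polys.∎
    where
    X Y : Poly
    X = r ⊛ x ⊕ δ ⊛ (s ⊛ y)
    Y = r ⊛ y ⊕ s ⊛ x

    X≈f,Y≈0 : X ≈ₚ f × Y ≈ₚ []
    X≈f,Y≈0 = Φ-injective X Y f [] (Polys.begin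
      Φ X Y              Polys.≈⟨ Φ-⊛ r s x y ⟨
      Φ r s ⊛ Φ x y      Polys.≈⟨ f∘g≈ΦΦ ⟨
      compose f g        Polys.≈⟨ ⊕-identityʳ (compose f g) ⟨
      compose f g ⊕ []   Polys.≈⟨ ⊕-cong (≈ₚ-refl {compose f g}) (⊛-zeroʳ T) ⟨
      Φ f []             Polys.∎)

  Norm-unit′ : ∀ r s {u} → u ≈ₚ Φ r s → Norm r s ∣ 1ₚ → u ∣ 1ₚ
  Norm-unit′ r s u≈Φ N∣1 = ∣ʳ-respˡ-≈ (≈ₚ-sym u≈Φ) (Norm-unit r s N∣1)

  -- By primality `f` divides the norm of one factor, with quotient `w`. Then `square-cancel` makes
  -- `w` or the norm of the other factor a unit, and the latter is impossible because an element
  -- with unit norm is a unit.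
  norm-associate : ∀ {f d} → Degree f d → Unsplittable f → ∀ u v →
    compose f g ≈ₚ u ⊛ v → u ∤ 1ₚ → v ∤ 1ₚ →
    ∃₂ λ r s → ∃[ w ] w ∣ 1ₚ × Norm r s ≈ₚ w ⊛ f
  norm-associate {f} f° unsplittable u v f∘g≈uv u∤1 v∤1 =
    let r , s , u≈Φrs = Φ-surjective u
        x , y , v≈Φxy = Φ-surjective v
        NN≈ff = norm-product f r s x y (≈ₚ-trans f∘g≈uv (⊛-cong u≈Φrs v≈Φxy))
    in [ (λ f∣N → r , s , associate f∣N (Norm x y) NN≈ff (v∤1 ∘ Norm-unit′ x y v≈Φxy))
       , (λ f∣N → x , y , associate f∣N (Norm r s) (≈ₚ-trans (⊛-comm (Norm x y) (Norm r s)) NN≈ff)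
                            (u∤1 ∘ Norm-unit′ r s u≈Φrs))
       ]′ (Euclid.prime f° unsplittable (Norm r s) (Norm x y) (f ∣, ≈ₚ-sym NN≈ff))
    where
    associate : ∀ {m} → f ∣ m → ∀ n → m ⊛ n ≈ₚ f ⊛ f → n ∤ 1ₚ → ∃[ w ] w ∣ 1ₚ × m ≈ₚ w ⊛ f
    associate {m} (w ∣, wf≈m) n mn≈ff n∤1 =
      w , [ (λ w∣1 → w∣1) , (λ n∣1 → contradiction n∣1 n∤1) ]′
            (square-cancel f° unsplittable w m n (≈ₚ-sym wf≈m) mn≈ff) , ≈ₚ-sym wf≈m

  eval-Norm : ∀ r s → eval (Norm r s) e ≡ eval r e * eval r e
  eval-Norm r s = begin
    eval (Norm r s) e                                  ≡⟨ evaluate-⊕ (r ⊛ r) (μ ⊛ (s ⊛ s)) ⟩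
    eval (r ⊛ r) e + eval (μ ⊛ (s ⊛ s)) e              ≡⟨ cong₂ _+_ (evaluate-⊛ r r) (evaluate-⊛ μ (s ⊛ s)) ⟩
    eval r e * eval r e + eval μ e * eval (s ⊛ s) e    ≡⟨ cong (λ x → eval r e * eval r e + x * eval (s ⊛ s) e) μ-root ⟩
    eval r e * eval r e + 0ℚ * eval (s ⊛ s) e          ≡⟨ cong (λ x → eval r e * eval r e + x) (ℚ.*-zeroˡ (eval (s ⊛ s) e)) ⟩
    eval r e * eval r e + 0ℚ                           ≡⟨ ℚ.+-identityʳ _ ⟩
    eval r e * eval r e                                ∎
    where
    open ≡-Reasoning
    open Eval e using (evaluate-⊕; evaluate-⊛)

  -- In even degree 2i the leading coefficient is l² with l from `r`, and (-a)^(2i) is itself a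
  -- square. In odd degree 2j + 1 it is -l²/a with l from `s`, and the odd power of -a supplies the
  -- missing factor: (-l²/a)(-a)^(2j+1) = (l (-a)^j)².
  Norm-leading : ∀ r s {d} → Degree (Norm r s) d →
    ∃[ k ] k ≢ 0ℚ × coeff (Norm r s) d * (- a) ^ℚ d ≡ k * k
  Norm-leading r s {d} N° = [ vanishing , [ even , odd ]′ ]′
    (parity-split (λ p → p ⊛ p) (λ p → μ ⊛ (p ⊛ p))
      (λ p≈0 → ⊛-cong p≈0 p≈0) (λ p≈0 → ⊛-≈[] μ (⊛-cong p≈0 p≈0))
      square-degree μ⊛square-degree r s)
    where
    open ≡-Reasoning

    Goal : ℕ → Set
    Goal d = ∃[ k ] k ≢ 0ℚ × coeff (Norm r s) d * (- a) ^ℚ d ≡ k * k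

    square-degree : ∀ {p n} → Degree p n → Degree (p ⊛ p) (n ℕ.+ n)
    square-degree {p} p° = degree-⊛ {p} {p} p° p°

    μ⊛square-degree : ∀ {p n} → Degree p n → Degree (μ ⊛ (p ⊛ p)) (suc (n ℕ.+ n))
    μ⊛square-degree {p} p° = degree-⊛ {μ} {p ⊛ p} μ-degree (square-degree p°)

    vanishing : r ≈ₚ [] × s ≈ₚ [] → Goal d
    vanishing (r≈0 , s≈0) = contradiction
      (⊕-cong {r ⊛ r} {[]} {μ ⊛ (s ⊛ s)} {[]} (⊛-cong r≈0 r≈0) (⊛-≈[] μ (⊛-cong s≈0 s≈0))) (degree-≉0 N°)

    even : (∃[ i ] Degree r i × DegreeBelow (μ ⊛ (s ⊛ s)) (i ℕ.+ i)) → Goal d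
    even (i , r° , s<) = subst Goal
      (degree-unique {Norm r s} (degree-⊕ {r ⊛ r} {μ ⊛ (s ⊛ s)} (square-degree r°) s<) N°)
      (l * q , *-≢0 (leading≢0 r°) (^-≢0 -a≢0 i) , (begin
        coeff (Norm r s) (i ℕ.+ i) * (- a) ^ℚ (i ℕ.+ i)
          ≡⟨ cong₂ _*_ (trans (below-⊕-top {r ⊛ r} s<) (coeff-⊛-top {r} {r} (beyond r°) (beyond r°)))
                       (^-homo-* (- a) i i) ⟩
        (l * l) * (q * q)
          ≡⟨ solve 2 (λ l q → (l :* l) :* (q :* q) := (l :* q) :* (l :* q)) refl l q ⟩
        (l * q) * (l * q) ∎))
      where
      l q : ℚ
      l = coeff r i
      q = (- a) ^ℚ i

    odd : (∃[ j ] Degree s j × DegreeBelow (r ⊛ r) (suc (j ℕ.+ j))) → Goal d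
    odd (j , s° , r<) = subst Goal
      (degree-unique {Norm r s} (degree-resp (⊕-comm (μ ⊛ (s ⊛ s)) (r ⊛ r))
        (degree-⊕ {μ ⊛ (s ⊛ s)} {r ⊛ r} (μ⊛square-degree s°) r<)) N°)
      (l * q , *-≢0 (leading≢0 s°) (^-≢0 -a≢0 j) , (begin
        coeff (Norm r s) (suc (j ℕ.+ j)) * (- a) ^ℚ suc (j ℕ.+ j)
          ≡⟨ cong₂ (λ x y → x * (- a * y)) top (^-homo-* (- a) j j) ⟩
        (m * (l * l)) * (- a * (q * q))
          ≡⟨ solve 4 (λ m a l q → (m :* (l :* l)) :* (:- a :* (q :* q))
               := (:- m :* a) :* ((l :* q) :* (l :* q))) refl m a l q ⟩
        (- m * a) * ((l * q) * (l * q))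
          ≡⟨ cong (_* ((l * q) * (l * q))) μ-leading ⟩
        1ℚ * ((l * q) * (l * q))
          ≡⟨ ℚ.*-identityˡ _ ⟩
        (l * q) * (l * q) ∎))
      where
      l q m : ℚ
      l = coeff s j
      q = (- a) ^ℚ j
      m = coeff μ 1

      top : coeff (Norm r s) (suc (j ℕ.+ j)) ≡ m * (l * l)
      top = begin
        coeff (r ⊛ r ⊕ μ ⊛ (s ⊛ s)) (suc (j ℕ.+ j))
          ≡⟨ coeff-≈ (⊕-comm (r ⊛ r) (μ ⊛ (s ⊛ s))) (suc (j ℕ.+ j)) ⟩
        coeff (μ ⊛ (s ⊛ s) ⊕ r ⊛ r) (suc (j ℕ.+ j))   ≡⟨ below-⊕-top {μ ⊛ (s ⊛ s)} {r ⊛ r} r< ⟩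
        coeff (μ ⊛ (s ⊛ s)) (suc (j ℕ.+ j))
          ≡⟨ coeff-⊛-top {μ} {s ⊛ s} {1} (beyond μ-degree) (beyond (square-degree s°)) ⟩
        m * coeff (s ⊛ s) (j ℕ.+ j)
          ≡⟨ cong (m *_) (coeff-⊛-top {s} {s} (beyond s°) (beyond s°)) ⟩
        m * (l * l) ∎

-- Rational points

linear : ℚ → Poly
linear x = - x ∷ 1ℚ ∷ []

eval-linear : ∀ x y → eval (linear x) y ≡ y + - x
eval-linear x y = solve 2 (λ x y → :- x :+ y :* (con 1ℚ :+ y :* con 0ℚ) := y :+ :- x) refl x y
  where open ℚSolver.+-*-Solver

eval-below-1 : ∀ p x → DegreeBelow p 1 → eval p x ≡ coeff p 0
eval-below-1 p x p< = trans (Eval.evaluate-cong x {p} {coeff p 0 ∷ []} (below-constant p<))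
  (trans (cong (λ y → coeff p 0 + y) (ℚ.*-zeroʳ x)) (ℚ.+-identityʳ (coeff p 0)))

factor-theorem : ∀ p x → eval p x ≡ 0ℚ → ∃[ q ] p ≈ₚ q ⊛ linear x
factor-theorem p x p[x]≡0 =
  let q , r , p≈qL+r , r< = division {linear x} (linear-degree λ ()) p
  in q , ≈ₚ-trans p≈qL+r (≈ₚ-trans (⊕-cong (≈ₚ-refl {q ⊛ linear x}) (remainder≈0 q r p≈qL+r r<))
                                   (⊕-identityʳ (q ⊛ linear x)))
  where
  open ≡-Reasoning

  remainder≈0 : ∀ q r → p ≈ₚ q ⊛ linear x ⊕ r → DegreeBelow r 1 → r ≈ₚ []
  remainder≈0 q r p≈qL+r r< = ≈ₚ-trans (below-constant r<)
    (≈ₚ-trans (∷-cong (trans (sym (eval-below-1 r x r<)) r[x]≡0) (≈ₚ-refl {[]})) (0∷-≈0 (≈ₚ-refl {[]})))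
    where
    r[x]≡0 : eval r x ≡ 0ℚ
    r[x]≡0 = begin
      eval r x                                 ≡⟨ ℚ.+-identityˡ (eval r x) ⟨
      0ℚ + eval r x                            ≡⟨ cong (_+ eval r x) (ℚ.*-zeroʳ (eval q x)) ⟨
      eval q x * 0ℚ + eval r x                 ≡⟨ cong (λ y → eval q x * y + eval r x)
                                                    (trans (eval-linear x x) (ℚ.+-inverseʳ x)) ⟨
      eval q x * eval (linear x) x + eval r x  ≡⟨ cong (_+ eval r x) (Eval.evaluate-⊛ x q (linear x)) ⟨
      eval (q ⊛ linear x) x + eval r x         ≡⟨ Eval.evaluate-⊕ x (q ⊛ linear x) r ⟨
      eval (q ⊛ linear x ⊕ r) x                ≡⟨ Eval.evaluate-cong x {p} {q ⊛ linear x ⊕ r} p≈qL+r ⟨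
      eval p x                                 ≡⟨ p[x]≡0 ⟩
      0ℚ                                       ∎

-- A root splits off `linear x`, and irreducibility leaves only a constant quotient, which is the
-- leading coefficient. The point `x + 1ℚ` is where `linear x` takes the value 1.
root⇒linear : ∀ {f d} → Degree f d → Unsplittable f → ∀ x → eval f x ≡ 0ℚ →
  d ≡ 1 × eval f (x + 1ℚ) ≡ coeff f d
root⇒linear {f} {d} f° unsplittable x f[x]≡0 =
  let q , f≈qL = factor-theorem f x f[x]≡0
  in [ unit-quotient q f≈qL , (λ L∣1 → contradiction (degree-unique (unit-degree L∣1) L°) λ ()) ]′
     (unsplittable q (linear x) f≈qL)
  where
  open ≡-Reasoning

  L° : Degree (linear x) 1
  L° = linear-degree λ ()

  unit-quotient : ∀ q → f ≈ₚ q ⊛ linear x → q ∣ 1ₚ → d ≡ 1 × eval f (x + 1ℚ) ≡ coeff f d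
  unit-quotient q f≈qL q∣1 = d≡1 , (begin
    eval f (x + 1ℚ)                            ≡⟨ Eval.evaluate-cong (x + 1ℚ) {f} {q ⊛ linear x} f≈qL ⟩
    eval (q ⊛ linear x) (x + 1ℚ)               ≡⟨ Eval.evaluate-⊛ (x + 1ℚ) q (linear x) ⟩
    eval q (x + 1ℚ) * eval (linear x) (x + 1ℚ)
      ≡⟨ cong₂ _*_ (eval-below-1 q (x + 1ℚ) (beyond q°)) (trans (eval-linear x (x + 1ℚ)) (x+1-x≡1 x)) ⟩
    coeff q 0 * 1ℚ                             ≡⟨ coeff-⊛-top {q} {linear x} {0} {1} (beyond q°) (beyond L°) ⟨
    coeff (q ⊛ linear x) 1                     ≡⟨ coeff-≈ f≈qL 1 ⟨
    coeff f 1                                  ≡⟨ cong (coeff f) d≡1 ⟨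
    coeff f d                                  ∎)
    where
    open ℚSolver.+-*-Solver
    x+1-x≡1 : ∀ x → (x + 1ℚ) + - x ≡ 1ℚ
    x+1-x≡1 = solve 1 (λ x → (x :+ con 1ℚ) :+ :- x := con 1ℚ) refl

    q° : Degree q 0
    q° = unit-degree q∣1

    d≡1 : d ≡ 1
    d≡1 = degree-unique f° (degree-resp (≈ₚ-sym f≈qL) (degree-⊛ {q} {linear x} q° L°))

-- Multiplying the two squares gives κ² A Y F = (k ρ)², and division by κ² A shows that z = k ρ / (κ
-- A) satisfies A z² = Y F. The inverse of κ A is passed as `i`, so the argument is polynomial.
scaled-square : ∀ {A κ i k ρ F Y} → i * (κ * A) ≡ 1ℚ → (κ * A) * Y ≡ k * k → κ * F ≡ ρ * ρ →
  A * ((k * ρ * i) * ((k * ρ * i) * 1ℚ)) ≡ Y * F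
scaled-square {A} {κ} {i} {k} {ρ} {F} {Y} iκA≡1 κAY≡kk κF≡ρρ = begin
  A * ((k * ρ * i) * ((k * ρ * i) * 1ℚ))
    ≡⟨ solve 4 (λ A i k ρ → A :* ((k :* ρ :* i) :* ((k :* ρ :* i) :* con 1ℚ))
         := A :* (i :* i) :* ((k :* k) :* (ρ :* ρ))) refl A i k ρ ⟩
  A * (i * i) * ((k * k) * (ρ * ρ))
    ≡⟨ cong₂ (λ x y → A * (i * i) * (x * y)) κAY≡kk κF≡ρρ ⟨
  A * (i * i) * ((κ * A * Y) * (κ * F))
    ≡⟨ solve 5 (λ A κ i F Y → A :* (i :* i) :* ((κ :* A :* Y) :* (κ :* F))
         := (i :* (κ :* A)) :* (i :* (κ :* A)) :* (Y :* F)) refl A κ i F Y ⟩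
  (i * (κ * A)) * (i * (κ * A)) * (Y * F)
    ≡⟨ cong (λ x → x * x * (Y * F)) iκA≡1 ⟩
  1ℚ * 1ℚ * (Y * F)   ≡⟨ ℚ.*-identityˡ (Y * F) ⟩
  Y * F               ∎
  where
  open ≡-Reasoning
  open ℚSolver.+-*-Solver

*-÷-cancel : ∀ x y .{{_ : NonZero y}} → (x * y) ℚ.÷ y ≡ x
*-÷-cancel x y = trans (ℚ.*-assoc x y (ℚ.1/ y)) (trans (cong (x *_) (ℚ.*-inverseʳ y)) (ℚ.*-identityʳ x))

fromℤ[t]-degree : ∀ f {d} → ℤ[t].HasDegree f d → Degree (fromℤ[t] f) d
fromℤ[t]-degree f {d} (lead≢0 , zeros) = degree
  (λ lead≡0 → lead≢0 (fromℤ-injective (trans (sym (coeff-fromℤ[t] f d)) lead≡0)))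
  (below λ n d<n → trans (coeff-fromℤ[t] f n) (cong fromℤ (zeros n d<n)))

Solution : ℕ → ℤ[t].Poly → ℤ → Set
Solution d f A = ∃[ x ] ∃[ y ] ∃[ z ] Σ (NonZero y) λ y≠0 →
  y * z ≢ 0ℚ × fromℤ A * (z ^ℚ 2) ≡ φ d f x y {{y≠0}}

module _ {d f A} (f-irr : IrreducibleInℤ[t] f) (f° : ℤ[t].HasDegree f d)
  (A≡lead : A ≡ ℤ[t].coeff f d) where

  private
    F : Poly
    F = fromℤ[t] f

    lead≡A : coeff F d ≡ fromℤ A
    lead≡A = trans (coeff-fromℤ[t] f d) (cong fromℤ (sym A≡lead))

    F° : Degree F d
    F° = fromℤ[t]-degree f f°

    unsplittable : Unsplittable F
    unsplittable = irreducible⇒unsplittable f-irr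

  -- The general construction would give z = 0 here. Instead `f` is linear and takes the value `A`
  -- at `e + 1ℚ`, which allows y = z = 1.
  root⇒solution : ∀ e → eval F e ≡ 0ℚ → Solution d f A
  root⇒solution e F[e]≡0 = e + 1ℚ , 1ℚ , 1ℚ , _ , (λ ()) , (begin
    fromℤ A * (1ℚ * (1ℚ * 1ℚ))                 ≡⟨ ℚ.*-identityʳ (fromℤ A) ⟩
    fromℤ A                                    ≡⟨ lead≡A ⟨
    coeff F d                                  ≡⟨ proj₂ value ⟨
    eval F (e + 1ℚ)                            ≡⟨ cong (eval F) (ℚ.*-identityʳ (e + 1ℚ)) ⟨
    eval F ((e + 1ℚ) ℚ.÷ 1ℚ)                   ≡⟨ ℚ.*-identityˡ (eval F ((e + 1ℚ) ℚ.÷ 1ℚ)) ⟨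
    1ℚ * eval F ((e + 1ℚ) ℚ.÷ 1ℚ)
      ≡⟨ cong (λ n → 1ℚ ^ℚ n * eval F ((e + 1ℚ) ℚ.÷ 1ℚ)) (proj₁ value) ⟨
    1ℚ ^ℚ d * eval F ((e + 1ℚ) ℚ.÷ 1ℚ)         ∎)
    where
    open ≡-Reasoning

    value : d ≡ 1 × eval F (e + 1ℚ) ≡ coeff F d
    value = root⇒linear F° unsplittable e F[e]≡0

  module _ {g} (g° : Degree g 2) where

    open QuadraticBasis g° (complete-square g°)
    open CompletedSquare (complete-square g°) using (e)

    private
      a : ℚ
      a = coeff g 2

      -a≢0 : - a ≢ 0ℚ
      -a≢0 = neg-≢0 (leading≢0 g°)

    -- Since `w` is a constant `κ`, the norm gives one square condition at `e` and one from the
    -- leading coefficient, and `scaled-square` combines them. That `e` is not a root makes `ρ`, and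
    -- with it z, nonzero.
    nonroot⇒solution : ∀ {r s w} → w ∣ 1ₚ → Norm r s ≈ₚ w ⊛ F → eval F e ≢ 0ℚ → Solution d f A
    nonroot⇒solution {r} {s} {w} w∣1 N≈wF F[e]≢0 =
      e * - a , - a , k * ρ * i , y≢0 ,
      *-≢0 -a≢0 (*-≢0 (*-≢0 k≢0 ρ≢0) i≢0) ,
      trans (scaled-square {fromℤ A} {κ} {i} {k} {ρ} {eval F e} {(- a) ^ℚ d} iκA≡1 κAY≡kk κF≡ρρ)
        (cong (λ x → (- a) ^ℚ d * eval F x) (sym (*-÷-cancel e (- a) {{y≢0}})))
      where
      κ ρ : ℚ
      κ = coeff w 0
      ρ = eval r e

      y≢0 : NonZero (- a)
      y≢0 = ℚ.≢-nonZero -a≢0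

      w° : Degree w 0
      w° = unit-degree w∣1

      leading = Norm-leading r s (degree-resp (≈ₚ-sym N≈wF) (degree-⊛ w° F°))

      k : ℚ
      k = proj₁ leading

      k≢0 : k ≢ 0ℚ
      k≢0 = proj₁ (proj₂ leading)

      κA≢0 : κ * fromℤ A ≢ 0ℚ
      κA≢0 = *-≢0 (leading≢0 w°) (λ A≡0 → leading≢0 F° (trans lead≡A A≡0))

      i : ℚ
      i = proj₁ (inverse κA≢0)

      iκA≡1 : i * (κ * fromℤ A) ≡ 1ℚ
      iκA≡1 = proj₂ (inverse κA≢0)

      i≢0 : i ≢ 0ℚ
      i≢0 i≡0 = contradiction
        (trans (sym iκA≡1) (trans (cong (_* (κ * fromℤ A)) i≡0) (ℚ.*-zeroˡ (κ * fromℤ A)))) λ ()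

      κAY≡kk : κ * fromℤ A * (- a) ^ℚ d ≡ k * k
      κAY≡kk = trans (cong (_* (- a) ^ℚ d) (sym (begin
        coeff (Norm r s) d   ≡⟨ coeff-≈ N≈wF d ⟩
        coeff (w ⊛ F) d      ≡⟨ coeff-⊛-top {w} {F} {0} {d} (beyond w°) (beyond F°) ⟩
        κ * coeff F d        ≡⟨ cong (κ *_) lead≡A ⟩
        κ * fromℤ A          ∎))) (proj₂ (proj₂ leading))
        where open ≡-Reasoning

      κF≡ρρ : κ * eval F e ≡ ρ * ρ
      κF≡ρρ = begin
        κ * eval F e                ≡⟨ cong (_* eval F e) (trans (cong (λ x → κ + x) (ℚ.*-zeroʳ e)) (ℚ.+-identityʳ κ)) ⟨
        eval (κ ∷ []) e * eval F e  ≡⟨ cong (_* eval F e) (evaluate-cong {w} {κ ∷ []} (below-constant (beyond w°))) ⟨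
        eval w e * eval F e         ≡⟨ evaluate-⊛ w F ⟨
        eval (w ⊛ F) e              ≡⟨ evaluate-cong {Norm r s} {w ⊛ F} N≈wF ⟨
        eval (Norm r s) e           ≡⟨ eval-Norm r s ⟩
        ρ * ρ                       ∎
        where
        open ≡-Reasoning
        open Eval e using (evaluate-cong; evaluate-⊛)

      ρ≢0 : ρ ≢ 0ℚ
      ρ≢0 ρ≡0 = *-≢0 (leading≢0 w°) F[e]≢0
        (trans κF≡ρρ (trans (cong (_* ρ) ρ≡0) (ℚ.*-zeroˡ ρ)))

theorem6p1 : (d : ℕ) (f : ℤ[t].Poly) (A : ℤ) →
    IrreducibleInℤ[t] f →
    ℤ[t].HasDegree f d →
    A ≡ ℤ[t].coeff f d →
    (∃[ g ] ℚ[t].HasDegree g 2 × ReducibleInℚ[t] (ℚ[t].compose (fromℤ[t] f) g)) →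
    ∃[ x ] ∃[ y ] ∃[ z ] Σ (NonZero y) λ y≠0 →
      y * z ≢ 0ℚ × fromℤ A * (z ^ℚ 2) ≡ φ d f x y {{y≠0}}
theorem6p1 d f A f-irr f° A≡lead (g , g-deg , _ , u , v , f∘g≈uv , u∤1 , v∤1) =
  case eval (fromℤ[t] f) e ℚ.≟ 0ℚ of λ
    { (yes root)   → root⇒solution f-irr f° A≡lead e root
    ; (no nonroot) →
      let r , s , w , w∣1 , N≈wF = norm-associate (fromℤ[t]-degree f f°) (irreducible⇒unsplittable f-irr) u v
            ⟨ f∘g≈uv ⟩ (λ { (i ∣, iu≈1) → u∤1 (i ∣, coeff-≈ iu≈1) })
            (λ { (i ∣, iv≈1) → v∤1 (i ∣, coeff-≈ iv≈1) })
      in nonroot⇒solution f-irr f° A≡lead g° {r} {s} w∣1 N≈wF nonroot }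
  where
  g° : Degree g 2
  g° = hasDegree⇒degree g-deg

  open CompletedSquare (complete-square g°) using (e)
  open QuadraticBasis g° (complete-square g°) using (norm-associate)
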